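{- Every Sturmian morphism different from $E$ and $Id$ is quasiperiodic; that is, for every Sturmian morphism $f\notin\{E,Id\}$ there exists a non-quasiperiodic infinite word $w$ over $\{a,b\}$ such that $f(w)$ is quasiperiodic.
   Context: The morphisms on $\{a,b\}^*$ (extended letterwise to infinite words) are: $E: a\mapsto b,\ b\mapsto a$; $L_a: a\mapsto a,\ b\mapsto ab$; $L_b: a\mapsto ba,\ b\mapsto b$; $R_a: a\mapsto a,\ b\mapsto ba$; $R_b: a\mapsto ab,\ b\mapsto b$; $Id$ is the identity. The Sturmian morphisms (the morphisms mapping every Sturmian word to a Sturmian word, where a Sturmian word is an infinite balanced non-ultimately-periodic word over $\{a,b\}$) are exactly the finite compositions of elements of $\{E,L_a,L_b,R_a,R_b\}$ (including $Id$), by a theorem of Séébold. An infinite (i.e. right-infinite) word $w$ is quasiperiodic if there exist a finite word $u$ and finite words $(p_n)_{n\ge 0}$ with $p_0=\varepsilon$ such that, for all $n\ge 0$, $0<|p_{n+1}|-|p_n|\le |u|$ and $p_nu$ is a prefix of $w$. -}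

module Defs where

open import Data.List.Base using (List; []; _∷_; [_]; _++_; length; filter; concatMap; applyUpTo)
open import Data.Nat.Base using (ℕ; suc; _+_; _≤_; _<_; ∣_-_∣)
open import Data.Product.Base using (∃; ∃-syntax; _×_)
open import Relation.Binary.Definitions using (DecidableEquality)
open import Relation.Binary.PropositionalEquality using (_≡_; refl)
open import Relation.Nullary.Decidable using (yes; no)
open import Relation.Nullary.Negation using (¬_)

data Letter : Set where
  a b : Letter

_≟_ : DecidableEquality Letter
a ≟ a = yes refl
a ≟ b = no λ ()
b ≟ a = no λ ()
b ≟ b = yes refl

Word : Set
Word = List Letter

InfWord : Set
InfWord = ℕ → Letter

occ : Letter → Word → ℕ
occ c u = length (filter (c ≟_) u)

-- The factor of length n starting at position i.
factor : InfWord → ℕ → ℕ → Word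
factor w i n = applyUpTo (λ k → w (i + k)) n

prefix : InfWord → ℕ → Word
prefix w n = applyUpTo w n

_IsPrefixOf_ : Word → InfWord → Set
u IsPrefixOf w = prefix w (length u) ≡ u

-- Over a two-letter alphabet it is enough to count the letter a.
Balanced : InfWord → Set
Balanced w = ∀ i j n → ∣ occ a (factor w i n) - occ a (factor w j n) ∣ ≤ 1

UltimatelyPeriodic : InfWord → Set
UltimatelyPeriodic w =
  ∃[ N ] ∃[ p ] 0 < p × (∀ n → N ≤ n → w (n + p) ≡ w n)

Sturmian : InfWord → Set
Sturmian w = Balanced w × ¬ UltimatelyPeriodic w

Quasiperiodic : InfWord → Set
Quasiperiodic w =
  ∃[ u ] ∃ λ (p : ℕ → Word) →
    p 0 ≡ [] ×
    (∀ n → length (p n) < length (p (suc n))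
         × length (p (suc n)) ≤ length (p n) + length u
         × (p n ++ u) IsPrefixOf w)

-- A morphism of {a,b}* is determined by the images of the letters, which may
-- be empty; equality of morphisms is therefore pointwise equality _≗_.
Morphism : Set
Morphism = Letter → Word

Id : Morphism
Id c = [ c ]

E : Morphism
E a = [ b ]
E b = [ a ]

_* : Morphism → Word → Word
f * = concatMap f

-- v = f(w).  If f is erasing then f(w) may be a finite word; the second
-- component requires it to be infinite, and together with the first it
-- determines v up to pointwise equality.
_[_]≈_ : Morphism → InfWord → InfWord → Set
f [ w ]≈ v =
  (∀ n → (f *) (prefix w n) IsPrefixOf v) ×
  (∀ m → ∃[ n ] m ≤ length ((f *) (prefix w n)))

SturmianMorphism : Morphism → Set
SturmianMorphism f = ∀ w → Sturmian w → ∃[ v ] f [ w ]≈ v × Sturmian v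

QuasiperiodicMorphism : Morphism → Set
QuasiperiodicMorphism f =
  ∃[ w ] ¬ Quasiperiodic w × ∃[ v ] f [ w ]≈ v × Quasiperiodic v

{-# OPTIONS --safe #-}

-- Write x = f(a) and y = f(b).  If one of x, y is a prefix or a suffix of the
-- other, then a word c d^ω (suffix) or d c d^ω (prefix), which is not
-- quasiperiodic, has an image that is.  To reach this situation, only the
-- following is used: f(w) is balanced for the mechanical word w of slope 1/√11
-- and for its image under E.  Balance forces the first letters of x and y, or
-- their last letters, to agree, unless {x, y} = {a, b}; then f = L_c ∘ g or
-- f = R_c ∘ g, and g inherits the balance of f up to shortening w by one
-- letter.  Now induct on |x| + |y|: prefixes and suffixes are preserved by
-- composition on the left, and the base case g ∈ {Id, E} is clear.
module Submission where

open import Data.List.Base using (InitLast; []; _∷_; [_]; _++_; length; filter; applyUpTo; replicate; take; drop; initLast; _∷ʳ′_)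
open import Data.List.Properties using (++-assoc; ++-identityʳ; length-++; filter-++; concatMap-++; length-applyUpTo; applyUpTo-∷ʳ; take++drop≡id; length-take; ++-conicalˡ; ++-conicalʳ; ∷-injectiveˡ; ∷-injectiveʳ)
open import Data.Nat.Base
open import Data.Nat.Divisibility using (_∣_; divides)
open import Data.Nat.Induction using (<-rec)
open import Data.Nat.Primality using (Prime; prime?; euclidsLemma)
open import Data.Nat.Properties hiding (_≟_)
open import Data.Nat.Tactic.RingSolver using (solve-∀)
open import Data.Product.Base using (∃-syntax; _×_; _,_; proj₁; proj₂)
open import Data.Sum.Base using (_⊎_; inj₁; inj₂)
open import Data.Empty using (⊥)
open import Function.Base using (_∘_; _$_)
open import Relation.Binary.Definitions using (tri<; tri≈; tri>)
open import Relation.Binary.PropositionalEquality hiding ([_])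
open import Relation.Nullary.Decidable using (Dec; yes; no; from-yes; map′; decidable-stable)
open import Relation.Nullary.Negation using (¬_; contradiction)
open import Defs

-- `SturmianMorphism` only says what `f` does to Sturmian words, so a factorisation into generators
-- has to be recovered from `f` itself. Two test words are used because no balanced word contains
-- both aa and bb: the word rich in a yields the factors xxx and xyx, the word rich in b yields yyy
-- and yxy. Cubes require a slope below 1/3, hence a radicand above 9; 11 is the first such prime,
-- and primality drives the irrationality descent.
--
-- Transferring balance from f to g needs one additional letter c beside the image of a factor. It
-- is found in the image of the next letter of w for L_c and of the previous letter for R_c. This is
-- the letter of w given up at each step, and the reason why the patterns must recur arbitrarily
-- far.
--
-- The leading d of d c d^ω matters in the prefix case: L_a sends a b^ω to a(ab)^ω, where aa occurs
-- only at the start, so this image is not quasiperiodic, while b a b^ω goes to aba(ab)^ω, with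
-- quasiperiod aba.

-- m ≼ n means m ≤ n/√11, and n ≺ m means n/√11 < m.  The slope 1/√11 is below
-- 1/3, so that three consecutive letters of the mechanical word contain at most
-- one occurrence of the rare letter.
record _≼_ (m n : ℕ) : Set where
  constructor ≼⁺
  field ≼⁻ : 11 * (m * m) ≤ n * n

record _≺_ (n m : ℕ) : Set where
  constructor ≺⁺
  field ≺⁻ : n * n < 11 * (m * m)

open _≼_
open _≺_

m*m≤n*n⇒m≤n : ∀ {m n} → m * m ≤ n * n → m ≤ n
m*m≤n*n⇒m≤n h = ≮⇒≥ λ n<m → <⇒≱ (*-mono-< n<m n<m) h

-- Only the cross term needs an argument: the product of the hypotheses bounds its square, and
-- `m*m≤n*n⇒m≤n` takes the root.
≼-+ : ∀ {m n m′ n′} → m ≼ n → m′ ≼ n′ → (m + m′) ≼ (n + n′)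
≼-+ {m} {n} {m′} {n′} (≼⁺ h) (≼⁺ h′) = ≼⁺ $ begin
  11 * ((m + m′) * (m + m′))                                   ≡⟨ expandˡ m m′ ⟩
  11 * (m * m) + 11 * (m′ * m′) + 2 * (11 * (m * m′))           ≤⟨ +-mono-≤ (+-mono-≤ h h′) (*-monoʳ-≤ 2 cross) ⟩
  n * n + n′ * n′ + 2 * (n * n′)                               ≡⟨ expandʳ n n′ ⟩
  (n + n′) * (n + n′)                                          ∎
  where
  open ≤-Reasoning
  expandˡ : ∀ x y → 11 * ((x + y) * (x + y)) ≡ 11 * (x * x) + 11 * (y * y) + 2 * (11 * (x * y))
  expandˡ = solve-∀
  expandʳ : ∀ x y → x * x + y * y + 2 * (x * y) ≡ (x + y) * (x + y)
  expandʳ = solve-∀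
  regroup : ∀ x y → 11 * (x * y) * (11 * (x * y)) ≡ 11 * (x * x) * (11 * (y * y))
  regroup = solve-∀
  cross : 11 * (m * m′) ≤ n * n′
  cross = m*m≤n*n⇒m≤n (begin
    11 * (m * m′) * (11 * (m * m′))     ≡⟨ regroup m m′ ⟩
    11 * (m * m) * (11 * (m′ * m′))     ≤⟨ *-mono-≤ h h′ ⟩
    n * n * (n′ * n′)                   ≡⟨ [m*n]*[o*p]≡[m*o]*[n*p] n n n′ n′ ⟩
    n * n′ * (n * n′)                   ∎)

≺-+ : ∀ {m n m′ n′} → n ≺ m → n′ ≺ m′ → (n + n′) ≺ (m + m′)
≺-+ {m} {n} {m′} {n′} (≺⁺ h) (≺⁺ h′) = ≺⁺ $ begin-strict
  (n + n′) * (n + n′)                                          ≡⟨ expandʳ n n′ ⟩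
  n * n + n′ * n′ + 2 * (n * n′)                               <⟨ +-mono-<-≤ (+-mono-< h h′) (*-monoʳ-≤ 2 cross) ⟩
  11 * (m * m) + 11 * (m′ * m′) + 2 * (11 * (m * m′))           ≡⟨ expandˡ m m′ ⟩
  11 * ((m + m′) * (m + m′))                                   ∎
  where
  open ≤-Reasoning
  expandˡ : ∀ x y → 11 * (x * x) + 11 * (y * y) + 2 * (11 * (x * y)) ≡ 11 * ((x + y) * (x + y))
  expandˡ = solve-∀
  expandʳ : ∀ x y → (x + y) * (x + y) ≡ x * x + y * y + 2 * (x * y)
  expandʳ = solve-∀
  regroup : ∀ x y → 11 * (x * x) * (11 * (y * y)) ≡ 11 * (x * y) * (11 * (x * y))
  regroup = solve-∀
  cross : n * n′ ≤ 11 * (m * m′)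
  cross = m*m≤n*n⇒m≤n (begin
    n * n′ * (n * n′)                   ≡⟨ [m*n]*[o*p]≡[m*o]*[n*p] n n′ n n′ ⟩
    n * n * (n′ * n′)                   ≤⟨ *-mono-≤ (<⇒≤ h) (<⇒≤ h′) ⟩
    11 * (m * m) * (11 * (m′ * m′))     ≡⟨ regroup m m′ ⟩
    11 * (m * m′) * (11 * (m * m′))     ∎)

≼-≺⇒< : ∀ {m n m′} → m ≼ n → n ≺ m′ → m < m′
≼-≺⇒< (≼⁺ h) (≺⁺ h′) = ≰⇒> λ m′≤m →
  <⇒≱ (≤-<-trans h h′) (*-monoʳ-≤ 11 (*-mono-≤ m′≤m m′≤m))

-- Irrationality of √11

prime-11 : Prime 11
prime-11 = from-yes (prime? 11)

11∣n*n⇒11∣n : ∀ n → 11 ∣ n * n → 11 ∣ n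
11∣n*n⇒11∣n n h with euclidsLemma n n prime-11 h
... | inj₁ d = d
... | inj₂ d = d

√11-irrational : ∀ p q → 0 < p → 11 * (q * q) ≢ p * p
√11-irrational = <-rec _ λ p rec q p>0 eq → descend p rec q p>0 eq (11∣n*n⇒11∣n p (divides (q * q) (trans (sym eq) (*-comm 11 (q * q)))))
  where
  descend : ∀ p → (∀ {p′} → p′ < p → ∀ q → 0 < p′ → 11 * (q * q) ≢ p′ * p′) →
            ∀ q → 0 < p → 11 * (q * q) ≡ p * p → 11 ∣ p → ⊥
  descend _ rec q () eq (divides zero refl)
  descend _ rec q p>0 eq (divides r@(suc _) refl) =
    halve (11∣n*n⇒11∣n q (divides (r * r) qq≡))
    where
    assoc : ∀ r → r * 11 * (r * 11) ≡ 11 * (r * r * 11)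
    assoc = solve-∀
    assoc′ : ∀ t → t * 11 * (t * 11) ≡ 11 * (t * t) * 11
    assoc′ = solve-∀
    qq≡ : q * q ≡ r * r * 11
    qq≡ = *-cancelˡ-≡ _ _ 11 (trans eq (assoc r))
    halve : 11 ∣ q → ⊥
    halve (divides t refl) = rec (m<m*n r 11 (s≤s (s≤s z≤n))) t (s≤s z≤n)
      (*-cancelʳ-≡ _ _ 11 (trans (sym (assoc′ t)) qq≡))

-- The integers 11q² and p² are distinct, so they differ by at least 1. After k steps this separates
-- the squares by at least k², whereas the offsets `N` and `s₀` contribute only terms of order k.
no-linear-progression : ∀ s₀ N p q → 0 < p →
  (∀ k → ((s₀ + k * q) ≼ (N + k * p)) × ((N + k * p) ≺ suc (s₀ + k * q))) → ⊥
no-linear-progression s₀ N p q p>0 h with <-cmp (11 * (q * q)) (p * p)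
... | tri≈ _ eq _ = √11-irrational p q p>0 eq
... | tri< lt _ _ = <-irrefl refl (begin-strict
  k * k * (11 * (q * q)) + k * k            ≡⟨ lhs k q ⟩
  k * k * suc (11 * (q * q))                ≤⟨ *-monoʳ-≤ (k * k) lt ⟩
  k * k * (p * p)                           ≡⟨ [m*n]*[o*p]≡[m*o]*[n*p] k k p p ⟩
  k * p * (k * p)                           ≤⟨ *-mono-≤ (m≤n+m (k * p) N) (m≤n+m (k * p) N) ⟩
  (N + k * p) * (N + k * p)                 <⟨ ≺⁻ (proj₂ (h k)) ⟩
  11 * ((t + k * q) * (t + k * q))           ≡⟨ rhs t k q ⟩
  k * k * (11 * (q * q)) + (11 * t * t + 22 * t * q * k)    ≤⟨ +-monoʳ-≤ (k * k * (11 * (q * q))) (+-monoˡ-≤ (22 * t * q * k) (*-monoʳ-≤ (11 * t) t≤k)) ⟩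
  k * k * (11 * (q * q)) + (11 * t * k + 22 * t * q * k)    ≡⟨ cong (k * k * (11 * (q * q)) +_) (sym (*-distribʳ-+ k (11 * t) (22 * t * q))) ⟩
  k * k * (11 * (q * q)) + k * k            ∎)
  where
  open ≤-Reasoning
  t = suc s₀
  -- Once `t * t` is bounded by `t * k`, the lower-order terms add up to exactly `k * k`.
  k = 11 * t + 22 * t * q
  t≤k : t ≤ k
  t≤k = ≤-trans (m≤m+n t (10 * t)) (m≤m+n (11 * t) (22 * t * q))
  lhs : ∀ k q → k * k * (11 * (q * q)) + k * k ≡ k * k * suc (11 * (q * q))
  lhs = solve-∀
  rhs : ∀ t k q → 11 * ((t + k * q) * (t + k * q)) ≡ k * k * (11 * (q * q)) + (11 * t * t + 22 * t * q * k)
  rhs = solve-∀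
... | tri> _ _ gt = <-irrefl refl (begin-strict
  k * k * (p * p) + (N * N + 2 * N * p * k)    ≤⟨ +-monoʳ-≤ (k * k * (p * p)) (+-monoˡ-≤ (2 * N * p * k) (*-monoʳ-≤ N N≤k)) ⟩
  k * k * (p * p) + (N * k + 2 * N * p * k)    <⟨ +-monoʳ-< (k * k * (p * p)) (+-monoˡ-< (2 * N * p * k) (*-monoˡ-< k (n<1+n N))) ⟩
  k * k * (p * p) + (suc N * k + 2 * N * p * k)    ≡⟨ cong (k * k * (p * p) +_) (sym (*-distribʳ-+ k (suc N) (2 * N * p))) ⟩
  k * k * (p * p) + k * k                   ≡⟨ lhs k p ⟩
  k * k * suc (p * p)                       ≤⟨ *-monoʳ-≤ (k * k) gt ⟩
  k * k * (11 * (q * q))                    ≡⟨ mid k q ⟩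
  11 * (k * q * (k * q))                    ≤⟨ *-monoʳ-≤ 11 (*-mono-≤ (m≤n+m (k * q) s₀) (m≤n+m (k * q) s₀)) ⟩
  11 * ((s₀ + k * q) * (s₀ + k * q))        ≤⟨ ≼⁻ (proj₁ (h k)) ⟩
  (N + k * p) * (N + k * p)                 ≡⟨ rhs N k p ⟩
  k * k * (p * p) + (N * N + 2 * N * p * k)    ∎)
  where
  open ≤-Reasoning
  -- `suc N` instead of `N` makes the lower-order terms strictly smaller than `k * k`, as `≼` is not
  -- strict.
  k = suc N + 2 * N * p
  N≤k : N ≤ k
  N≤k = ≤-trans (n≤1+n N) (m≤m+n (suc N) (2 * N * p))
  lhs : ∀ k p → k * k * (p * p) + k * k ≡ k * k * suc (p * p)
  lhs = solve-∀
  mid : ∀ k q → k * k * (11 * (q * q)) ≡ 11 * (k * q * (k * q))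
  mid = solve-∀
  rhs : ∀ N k p → (N + k * p) * (N + k * p) ≡ k * k * (p * p) + (N * N + 2 * N * p * k)
  rhs = solve-∀

-- The integer part of n/√11

jump? : ∀ s n → Dec (suc s ≼ suc n)
jump? s n = map′ ≼⁺ ≼⁻ (11 * (suc s * suc s) ≤? suc n * suc n)

-- The decision is an argument so that the invariants of `slope` follow by matching on it.
next : ∀ s {n} → Dec (suc s ≼ suc n) → ℕ
next s (yes _) = suc s
next s (no _)  = s

-- slope n = ⌊n/√11⌋
slope : ℕ → ℕ
slope zero    = 0
slope (suc n) = next (slope n) (jump? (slope n) n)

next-≼ : ∀ s n (j : Dec (suc s ≼ suc n)) → s ≼ n → next s j ≼ suc n
next-≼ s n (yes h) _ = h
next-≼ s n (no _)  (≼⁺ h) = ≼⁺ $ ≤-trans h (*-mono-≤ (n≤1+n n) (n≤1+n n))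

next-≺ : ∀ s n (j : Dec (suc s ≼ suc n)) → n ≺ suc s → suc n ≺ suc (next s j)
next-≺ s n (yes _) h = subst₂ _≺_ (+-comm n 1) (+-comm (suc s) 1)
  -- The added inequality is `1 ≺ 1`, that is 1 < 11.
  (≺-+ h (≺⁺ (s≤s (s≤s z≤n))))
next-≺ s n (no ¬h) _ = ≺⁺ (≰⇒> (¬h ∘ ≼⁺))

slope-≼ : ∀ n → slope n ≼ n
slope-≼ zero    = ≼⁺ z≤n
slope-≼ (suc n) = next-≼ (slope n) n (jump? (slope n) n) (slope-≼ n)

slope-≺ : ∀ n → n ≺ suc (slope n)
slope-≺ zero    = ≺⁺ (s≤s z≤n)
slope-≺ (suc n) = next-≺ (slope n) n (jump? (slope n) n) (slope-≺ n)

slope-superadditive : ∀ i n → slope i + slope n ≤ slope (i + n)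
slope-superadditive i n =
  s≤s⁻¹ (≼-≺⇒< (≼-+ (slope-≼ i) (slope-≼ n)) (slope-≺ (i + n)))

slope-+-≤ : ∀ i n → slope (i + n) ≤ suc (slope i + slope n)
slope-+-≤ i n = s≤s⁻¹ (subst (slope (i + n) <_) (cong suc (+-suc (slope i) (slope n)))
  (≼-≺⇒< (slope-≼ (i + n)) (≺-+ (slope-≺ i) (slope-≺ n))))

slope-3+ : ∀ n → slope (3 + n) ≤ suc (slope n)
slope-3+ n = s≤s⁻¹ (≼-≺⇒< (slope-≼ (3 + n)) (≺-+ 3≺1 (slope-≺ n)))
  where
  3≺1 : 3 ≺ 1
  3≺1 = ≺⁺ (from-yes (9 <? 11))

slope-not-eventually-linear : ∀ N p q → 0 < p → ¬ (∀ k → slope (N + k * p) ≡ slope N + k * q)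
slope-not-eventually-linear N p q p>0 h = no-linear-progression (slope N) N p q p>0 λ k →
  subst (_≼ (N + k * p)) (h k) (slope-≼ (N + k * p)) ,
  subst (λ s → (N + k * p) ≺ suc s) (h k) (slope-≺ (N + k * p))

-- Letters and their numbers of occurrences

opp : Letter → Letter
opp a = b
opp b = a

c≢opp : ∀ c → c ≢ opp c
c≢opp a ()
c≢opp b ()

opp-involutive : ∀ c → opp (opp c) ≡ c
opp-involutive a = refl
opp-involutive b = refl

≡⊎≡opp : ∀ c e → e ≡ c ⊎ e ≡ opp c
≡⊎≡opp a a = inj₁ refl
≡⊎≡opp a b = inj₂ refl
≡⊎≡opp b a = inj₂ refl
≡⊎≡opp b b = inj₁ refl

occ-same : ∀ c u → occ c (c ∷ u) ≡ suc (occ c u)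
occ-same a _ = refl
occ-same b _ = refl

occ-opp : ∀ c u → occ c (opp c ∷ u) ≡ occ c u
occ-opp a _ = refl
occ-opp b _ = refl

opp-occ : ∀ c u → occ (opp c) (c ∷ u) ≡ occ (opp c) u
opp-occ a _ = refl
opp-occ b _ = refl

occ-++ : ∀ c u v → occ c (u ++ v) ≡ occ c u + occ c v
occ-++ c u v = trans (cong length (filter-++ (c ≟_) u v)) (length-++ (filter (c ≟_) u))

occ+occ-opp : ∀ c u → occ c u + occ (opp c) u ≡ length u
occ+occ-opp a []      = refl
occ+occ-opp b []      = refl
occ+occ-opp a (a ∷ u) = cong suc (occ+occ-opp a u)
occ+occ-opp a (b ∷ u) = trans (+-suc _ _) (cong suc (occ+occ-opp a u))
occ+occ-opp b (a ∷ u) = trans (+-suc _ _) (cong suc (occ+occ-opp b u))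
occ+occ-opp b (b ∷ u) = cong suc (occ+occ-opp b u)

-- At equal lengths, a surplus of one letter is a deficit of the other.
occ-≤-opp : ∀ c u v → length u ≡ length v →
            occ (opp c) v ≤ suc (occ (opp c) u) → occ c u ≤ suc (occ c v)
occ-≤-opp c u v |u|≡|v| h = +-cancelʳ-≤ (occ (opp c) u) _ _ (begin
  occ c u + occ (opp c) u          ≡⟨ trans (occ+occ-opp c u) |u|≡|v| ⟩
  length v                         ≡⟨ sym (occ+occ-opp c v) ⟩
  occ c v + occ (opp c) v          ≤⟨ +-monoʳ-≤ (occ c v) h ⟩
  occ c v + suc (occ (opp c) u)    ≡⟨ +-suc (occ c v) _ ⟩
  suc (occ c v) + occ (opp c) u    ∎)
  where open ≤-Reasoning

-- The mechanical word of slope 1/√11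

digit : ∀ {P : Set} → Letter → Dec P → Letter
digit c (yes _) = opp c
digit c (no _)  = c

-- c is the frequent letter.
mechanical : Letter → InfWord
mechanical c n = digit c (jump? (slope n) n)

-- One slope sequence drives both test words, so the letter is given for both choices of the
-- frequent letter at once.
Jump Flat : ℕ → Set
Jump n = slope (suc n) ≡ suc (slope n) × (∀ c → mechanical c n ≡ opp c)
Flat n = slope (suc n) ≡ slope n × (∀ c → mechanical c n ≡ c)

jump⊎flat : ∀ n → Jump n ⊎ Flat n
jump⊎flat n = view (jump? (slope n) n)
  where
  view : (j : Dec (suc (slope n) ≼ suc n)) →
         (next (slope n) j ≡ suc (slope n) × (∀ c → digit c j ≡ opp c)) ⊎
         (next (slope n) j ≡ slope n × (∀ c → digit c j ≡ c))
  view (yes _) = inj₁ (refl , λ _ → refl)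
  view (no _)  = inj₂ (refl , λ _ → refl)

slope-mono-suc : ∀ n → slope n ≤ slope (suc n)
slope-mono-suc n with jump⊎flat n
... | inj₁ (eq , _) = ≤-trans (n≤1+n (slope n)) (≤-reflexive (sym eq))
... | inj₂ (eq , _) = ≤-reflexive (sym eq)

-- The count telescopes, because `opp c` stands exactly at the jumps of `slope`.
occ-mechanical : ∀ c i n → occ (opp c) (factor (mechanical c) i n) + slope i ≡ slope (i + n)
occ-mechanical c i zero = cong slope (sym (+-identityʳ i))
occ-mechanical c i (suc n) = begin
  occ (opp c) (factor w i (suc n)) + slope i
    ≡⟨ cong (λ u → occ (opp c) u + slope i) (sym (applyUpTo-∷ʳ (λ k → w (i + k)) n)) ⟩
  occ (opp c) (factor w i n ++ [ w (i + n) ]) + slope i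
    ≡⟨ cong (_+ slope i) (occ-++ (opp c) (factor w i n) _) ⟩
  occ (opp c) (factor w i n) + occ (opp c) [ w (i + n) ] + slope i
    ≡⟨ +-assoc (occ (opp c) (factor w i n)) _ _ ⟩
  occ (opp c) (factor w i n) + (occ (opp c) [ w (i + n) ] + slope i)
    ≡⟨ cong (occ (opp c) (factor w i n) +_) (+-comm _ (slope i)) ⟩
  occ (opp c) (factor w i n) + (slope i + occ (opp c) [ w (i + n) ])
    ≡⟨ sym (+-assoc (occ (opp c) (factor w i n)) _ _) ⟩
  occ (opp c) (factor w i n) + slope i + occ (opp c) [ w (i + n) ]
    ≡⟨ cong (_+ occ (opp c) [ w (i + n) ]) (occ-mechanical c i n) ⟩
  slope (i + n) + occ (opp c) [ w (i + n) ]
    ≡⟨ last-letter (jump⊎flat (i + n)) ⟩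
  slope (suc (i + n))
    ≡⟨ cong slope (sym (+-suc i n)) ⟩
  slope (i + suc n) ∎
  where
  open ≡-Reasoning
  w = mechanical c
  last-letter : Jump (i + n) ⊎ Flat (i + n) →
                slope (i + n) + occ (opp c) [ w (i + n) ] ≡ slope (suc (i + n))
  last-letter (inj₁ (eq , v)) rewrite v c | occ-same (opp c) [] = trans (+-comm _ 1) (sym eq)
  last-letter (inj₂ (eq , v)) rewrite v c | opp-occ c []        = trans (+-identityʳ _) (sym eq)

occ-mechanical-≤ : ∀ c i j n →
  occ (opp c) (factor (mechanical c) i n) ≤ suc (occ (opp c) (factor (mechanical c) j n))
occ-mechanical-≤ c i j n = ≤-trans upper (s≤s lower)
  where
  open ≤-Reasoning
  upper : occ (opp c) (factor (mechanical c) i n) ≤ suc (slope n)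
  upper = +-cancelʳ-≤ (slope i) _ _ (begin
    occ (opp c) (factor (mechanical c) i n) + slope i    ≡⟨ occ-mechanical c i n ⟩
    slope (i + n)                                        ≤⟨ slope-+-≤ i n ⟩
    suc (slope i + slope n)                              ≡⟨ cong suc (+-comm (slope i) _) ⟩
    suc (slope n) + slope i                              ∎)
  lower : slope n ≤ occ (opp c) (factor (mechanical c) j n)
  lower = +-cancelʳ-≤ (slope j) _ _ (begin
    slope n + slope j                                    ≡⟨ +-comm (slope n) _ ⟩
    slope j + slope n                                    ≤⟨ slope-superadditive j n ⟩
    slope (j + n)                                        ≡⟨ sym (occ-mechanical c j n) ⟩
    occ (opp c) (factor (mechanical c) j n) + slope j    ∎)

∣-∣≤1 : ∀ {m n} → m ≤ suc n → n ≤ suc m → ∣ m - n ∣ ≤ 1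
∣-∣≤1 {m} {n} m≤ n≤ with ∣m-n∣≡[m∸n]∨[n∸m] m n
... | inj₁ eq = subst (_≤ 1) (sym eq) (m≤n+o⇒m∸n≤o m n (≤-trans m≤ (≤-reflexive (+-comm 1 n))))
... | inj₂ eq = subst (_≤ 1) (sym eq) (m≤n+o⇒m∸n≤o n m (≤-trans n≤ (≤-reflexive (+-comm 1 m))))

length-factor : ∀ w i j n → length (factor w i n) ≡ length (factor w j n)
length-factor w i j n = trans (length-applyUpTo (λ k → w (i + k)) n) (sym (length-applyUpTo (λ k → w (j + k)) n))

mechanical-balanced : ∀ c → Balanced (mechanical c)
-- `Balanced` counts `a`, here the frequent letter; the bound is carried over from the rare one.
mechanical-balanced a i j n = ∣-∣≤1 (bound i j) (bound j i)
  where
  bound : ∀ i j → occ a (factor (mechanical a) i n) ≤ suc (occ a (factor (mechanical a) j n))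
  bound i j = occ-≤-opp a (factor (mechanical a) i n) (factor (mechanical a) j n)
    (length-factor (mechanical a) i j n) (occ-mechanical-≤ a j i n)
mechanical-balanced b i j n = ∣-∣≤1 (occ-mechanical-≤ b i j n) (occ-mechanical-≤ b j i n)

slope-increments-aperiodic : ∀ N p q → 0 < p → ¬ (∀ n → N ≤ n → slope (n + p) ≡ slope n + q)
slope-increments-aperiodic N p q p>0 h = slope-not-eventually-linear N p q p>0 linear
  where
  open ≡-Reasoning
  linear : ∀ k → slope (N + k * p) ≡ slope N + k * q
  linear zero    = trans (cong slope (+-identityʳ N)) (sym (+-identityʳ (slope N)))
  linear (suc k) = begin
    slope (N + (p + k * p))    ≡⟨ cong (λ m → slope (N + m)) (+-comm p (k * p)) ⟩
    slope (N + (k * p + p))    ≡⟨ cong slope (sym (+-assoc N (k * p) p)) ⟩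
    slope (N + k * p + p)      ≡⟨ h (N + k * p) (m≤m+n N (k * p)) ⟩
    slope (N + k * p) + q      ≡⟨ cong (_+ q) (linear k) ⟩
    slope N + k * q + q        ≡⟨ +-assoc (slope N) (k * q) q ⟩
    slope N + (k * q + q)      ≡⟨ cong (slope N +_) (+-comm (k * q) q) ⟩
    slope N + (q + k * q)      ∎

slope-increment : ∀ c m n → mechanical c m ≡ mechanical c n →
                  slope (suc m) + slope n ≡ slope (suc n) + slope m
slope-increment c m n eq with jump⊎flat m | jump⊎flat n
... | inj₁ (p , _) | inj₁ (q , _) rewrite p | q = cong suc (+-comm (slope m) (slope n))
... | inj₂ (p , _) | inj₂ (q , _) rewrite p | q = +-comm (slope m) (slope n)
... | inj₁ (_ , p) | inj₂ (_ , q) = contradiction (trans (sym (q c)) (trans (sym eq) (p c))) (c≢opp c)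
... | inj₂ (_ , p) | inj₁ (_ , q) = contradiction (trans (sym (p c)) (trans eq (q c))) (c≢opp c)

-- A period `p` of the letters makes the increment of `slope` over `p` steps the same number `q`
-- from `N` on, so `slope` would grow at the rational rate q/p.
mechanical-aperiodic : ∀ c → ¬ UltimatelyPeriodic (mechanical c)
mechanical-aperiodic c (N , p , p>0 , per) = slope-increments-aperiodic N p q p>0
  λ n N≤n → subst (λ m → slope (m + p) ≡ slope m + q) (m+[n∸m]≡n N≤n) (shift (n ∸ N))
  where
  open ≡-Reasoning
  q = slope (N + p) ∸ slope N
  slope-mono : ∀ k → slope N ≤ slope (N + k)
  slope-mono k = ≤-trans (m≤m+n (slope N) (slope k)) (slope-superadditive N k)
  shift : ∀ k → slope (N + k + p) ≡ slope (N + k) + q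
  shift zero rewrite +-identityʳ N = sym (m+[n∸m]≡n (slope-mono p))
  shift (suc k) rewrite +-suc N k = +-cancelʳ-≡ (slope (N + k)) _ _ (begin
    slope (suc (N + k + p)) + slope (N + k)      ≡⟨ slope-increment c (N + k + p) (N + k) (per (N + k) (m≤m+n N k)) ⟩
    slope (suc (N + k)) + slope (N + k + p)      ≡⟨ cong (slope (suc (N + k)) +_) (trans (shift k) (+-comm _ q)) ⟩
    slope (suc (N + k)) + (q + slope (N + k))    ≡⟨ sym (+-assoc (slope (suc (N + k))) q _) ⟩
    slope (suc (N + k)) + q + slope (N + k)      ∎)

mechanical-sturmian : ∀ c → Sturmian (mechanical c)
mechanical-sturmian c = mechanical-balanced c , mechanical-aperiodic c

-- Recurrence of the patterns ccc and cdc

flat-run-recurs : ∀ N → ¬ ¬ (∃[ n ] N ≤ n × Flat n × Flat (1 + n) × Flat (2 + n))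
-- Without such runs every window of three has a jump, and by `slope-3+` only one, so `slope` would
-- gain 1 every 3 steps.
flat-run-recurs N none = slope-increments-aperiodic N 3 1 (s≤s z≤n) λ n N≤n →
  subst₂ (λ m s → slope m ≡ s) (+-comm 3 n) (+-comm 1 (slope n))
    (≤-antisym (slope-3+ n) (jumps n N≤n (jump⊎flat n) (jump⊎flat (1 + n)) (jump⊎flat (2 + n))))
  where
  jumps : ∀ n → N ≤ n → Jump n ⊎ Flat n → Jump (1 + n) ⊎ Flat (1 + n) →
          Jump (2 + n) ⊎ Flat (2 + n) → suc (slope n) ≤ slope (3 + n)
  jumps n _ (inj₁ (eq , _)) _ _ =
    ≤-trans (≤-reflexive (sym eq)) (≤-trans (slope-mono-suc (1 + n)) (slope-mono-suc (2 + n)))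
  jumps n _ (inj₂ _) (inj₁ (eq , _)) _ =
    ≤-trans (s≤s (slope-mono-suc n)) (≤-trans (≤-reflexive (sym eq)) (slope-mono-suc (2 + n)))
  jumps n _ (inj₂ _) (inj₂ _) (inj₁ (eq , _)) =
    ≤-trans (s≤s (≤-trans (slope-mono-suc n) (slope-mono-suc (1 + n)))) (≤-reflexive (sym eq))
  jumps n N≤n (inj₂ f₀) (inj₂ f₁) (inj₂ f₂) = contradiction (n , N≤n , f₀ , f₁ , f₂) none

no-double-jump : ∀ n → Jump n → ¬ Jump (1 + n)
no-double-jump n (eq , _) (eq′ , _) = <⇒≱ (n<1+n (suc (slope n))) (≤-trans
  (≤-reflexive (sym (trans eq′ (cong suc eq))))
  (≤-trans (slope-mono-suc (2 + n)) (slope-3+ n)))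

isolated-jump-recurs : ∀ N → ¬ ¬ (∃[ n ] N ≤ n × Flat n × Jump (1 + n) × Flat (2 + n))
-- Jumps are never adjacent, so without isolated ones `slope` would be eventually constant. The
-- bound is `suc N` because the window opens one letter before the jump.
isolated-jump-recurs N none = slope-increments-aperiodic (suc N) 1 0 (s≤s z≤n) constant
  where
  constant : ∀ n → suc N ≤ n → slope (n + 1) ≡ slope n + 0
  constant (suc n) (s≤s N≤n) = trans (cong slope (+-comm (suc n) 1)) (trans
    (flat (jump⊎flat n) (jump⊎flat (1 + n)) (jump⊎flat (2 + n))) (sym (+-identityʳ _)))
    where
    flat : Jump n ⊎ Flat n → Jump (1 + n) ⊎ Flat (1 + n) →
           Jump (2 + n) ⊎ Flat (2 + n) → slope (2 + n) ≡ slope (1 + n)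
    flat _         (inj₂ (eq , _)) _         = eq
    flat (inj₁ j)  (inj₁ j′)       _         = contradiction j′ (no-double-jump n j)
    flat _         (inj₁ j′)       (inj₁ j″) = contradiction j″ (no-double-jump (1 + n) j′)
    flat (inj₂ f)  (inj₁ j)        (inj₂ f′) = contradiction (n , N≤n , f , j , f′) none

-- Factors and balanced languages

record _⊑_ (u v : Word) : Set where
  constructor ⟨_,_,_⟩
  field
    before after : Word
    splits       : before ++ u ++ after ≡ v

⊑-refl : ∀ {u} → u ⊑ u
⊑-refl {u} = ⟨ [] , [] , ++-identityʳ u ⟩

⊑-++ˡ : ∀ p {u v} → u ⊑ v → u ⊑ (p ++ v)
⊑-++ˡ p {u} ⟨ p′ , q , refl ⟩ = ⟨ p ++ p′ , q , ++-assoc p p′ (u ++ q) ⟩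

⊑-++ʳ : ∀ q {u v} → u ⊑ v → u ⊑ (v ++ q)
⊑-++ʳ q {u} ⟨ p , q′ , refl ⟩ = ⟨ p , q′ ++ q ,
  sym (trans (++-assoc p (u ++ q′) q) (cong (p ++_) (++-assoc u q′ q))) ⟩

⊑-trans : ∀ {u v w} → u ⊑ v → v ⊑ w → u ⊑ w
⊑-trans u⊑v ⟨ p , q , eq ⟩ = subst (_ ⊑_) eq (⊑-++ˡ p (⊑-++ʳ q u⊑v))

Factorial BalancedLanguage : (Word → Set) → Set
Factorial F = ∀ {u v} → u ⊑ v → F v → F u
BalancedLanguage F = ∀ u v → F u → F v → length u ≡ length v → ∀ c → occ c u ≤ suc (occ c v)

balanced-from-letter : ∀ {F : Word → Set} c →
  (∀ u v → F u → F v → length u ≡ length v → occ c u ≤ suc (occ c v)) → BalancedLanguage F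
balanced-from-letter c bal u v Fu Fv |u|≡|v| e with ≡⊎≡opp c e
... | inj₁ refl = bal u v Fu Fv |u|≡|v|
... | inj₂ refl = occ-≤-opp (opp c) u v |u|≡|v|
  (subst (λ d → occ d v ≤ suc (occ d u)) (sym (opp-involutive c)) (bal v u Fv Fu (sym |u|≡|v|)))

no-two-squares : ∀ {F : Word → Set} → BalancedLanguage F → ∀ c → F (c ∷ c ∷ []) → ¬ F (opp c ∷ opp c ∷ [])
no-two-squares bal a F₁ F₂ = <⇒≱ (s≤s (s≤s z≤n)) (bal _ _ F₁ F₂ refl a)
no-two-squares bal b F₁ F₂ = <⇒≱ (s≤s (s≤s z≤n)) (bal _ _ F₁ F₂ refl b)

-- The morphisms L_c and R_c

-- The length of `mark c e` is `occ (opp c) [ e ]` by definition, the form that `length-L` relies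
-- on.
mark : Letter → Morphism
mark c e = filter (opp c ≟_) [ e ]

L R : Letter → Morphism
L c e = c ∷ mark c e
R c e = mark c e ++ [ c ]

-- The two morphisms are conjugate by c. This lets `balanced-reflect`, stated with `L`, serve for
-- `R` as well.
L-R : ∀ c u → (L c *) u ++ [ c ] ≡ c ∷ (R c *) u
L-R c []      = refl
L-R c (e ∷ u) = cong (c ∷_) (begin
  (mark c e ++ (L c *) u) ++ [ c ]    ≡⟨ ++-assoc (mark c e) _ _ ⟩
  mark c e ++ (L c *) u ++ [ c ]      ≡⟨ cong (mark c e ++_) (L-R c u) ⟩
  mark c e ++ c ∷ (R c *) u           ≡⟨ sym (++-assoc (mark c e) [ c ] _) ⟩
  (mark c e ++ [ c ]) ++ (R c *) u    ∎)
  where open ≡-Reasoning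

occ-mark : ∀ c e → occ c (mark c e) ≡ 0
occ-mark a a = refl
occ-mark a b = refl
occ-mark b a = refl
occ-mark b b = refl

occ-L : ∀ c u → occ c ((L c *) u) ≡ length u
occ-L c []      = refl
occ-L c (e ∷ u) = begin
  occ c (c ∷ mark c e ++ (L c *) u)                ≡⟨ occ-same c _ ⟩
  suc (occ c (mark c e ++ (L c *) u))              ≡⟨ cong suc (occ-++ c (mark c e) _) ⟩
  suc (occ c (mark c e) + occ c ((L c *) u))       ≡⟨ cong₂ (λ x y → suc (x + y)) (occ-mark c e) (occ-L c u) ⟩
  suc (length u)                                   ∎
  where open ≡-Reasoning

length-L : ∀ c u → length ((L c *) u) ≡ length u + occ (opp c) u
length-L c []      = refl
length-L c (e ∷ u) = cong suc (begin
  length (mark c e ++ (L c *) u)                       ≡⟨ length-++ (mark c e) ⟩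
  occ (opp c) [ e ] + length ((L c *) u)               ≡⟨ cong (occ (opp c) [ e ] +_) (trans (length-L c u) (+-comm (length u) _)) ⟩
  occ (opp c) [ e ] + (occ (opp c) u + length u)       ≡⟨ sym (+-assoc (occ (opp c) [ e ]) _ _) ⟩
  occ (opp c) [ e ] + occ (opp c) u + length u         ≡⟨ cong (_+ length u) (sym (occ-++ (opp c) [ e ] u)) ⟩
  occ (opp c) (e ∷ u) + length u                       ≡⟨ +-comm _ (length u) ⟩
  length u + occ (opp c) (e ∷ u)                       ∎)
  where open ≡-Reasoning

length-R : ∀ c u → length ((R c *) u) ≡ length u + occ (opp c) u
length-R c u = suc-injective (begin
  suc (length ((R c *) u))                   ≡⟨ cong length (sym (L-R c u)) ⟩
  length ((L c *) u ++ [ c ])                ≡⟨ length-++ ((L c *) u) ⟩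
  length ((L c *) u) + 1                     ≡⟨ +-comm _ 1 ⟩
  suc (length ((L c *) u))                   ≡⟨ cong suc (length-L c u) ⟩
  suc (length u + occ (opp c) u)             ∎)
  where open ≡-Reasoning

-- If u had two more letters opp c than v, then L_c(v)c would have two more
-- letters c than the word of the same length obtained from L_c(u) by deleting
-- its first letter and truncating.
balanced-reflect : ∀ {F G : Word → Set} c → Factorial F → BalancedLanguage F →
  (∀ {u} → G u → F ((L c *) u ++ [ c ])) → BalancedLanguage G
balanced-reflect {F} {G} c fac bal G⇒F = balanced-from-letter {G} (opp c) bound
  where
  open ≤-Reasoning
  bound : ∀ u v → G u → G v → length u ≡ length v → occ (opp c) u ≤ suc (occ (opp c) v)
  bound []       _ _  _  _       = z≤n
  bound (e ∷ u′) v Gu Gv |u|≡|v| = ≮⇒≥ λ unbalanced →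
    <⇒≱ (n<1+n (length v)) (begin
      suc (length v)               ≡⟨ sym occ-V ⟩
      occ c V                      ≤⟨ bal _ _ (G⇒F Gv) FZ (|V|≡ unbalanced) c ⟩
      suc (occ c (take (length V) Z))    ≤⟨ s≤s occ-take ⟩
      suc (occ c Z)                ≡⟨ sym (occ-same c Z) ⟩
      occ c ((L c *) u)            ≡⟨ occ-L c u ⟩
      length u                     ≡⟨ |u|≡|v| ⟩
      length v                     ∎)
    where
    u = e ∷ u′
    V = (L c *) v ++ [ c ]
    Z = mark c e ++ (L c *) u′
    FZ : F (take (length V) Z)
    FZ = fac (⊑-trans ⟨ [] , drop (length V) Z , take++drop≡id (length V) Z ⟩
                      ⟨ [ c ] , [ c ] , refl ⟩) (G⇒F Gu)
    occ-take : occ c (take (length V) Z) ≤ occ c Z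
    occ-take = subst (occ c (take (length V) Z) ≤_)
      (trans (sym (occ-++ c (take (length V) Z) (drop (length V) Z))) (cong (occ c) (take++drop≡id (length V) Z)))
      (m≤m+n _ _)
    occ-V : occ c V ≡ suc (length v)
    occ-V = trans (occ-++ c ((L c *) v) [ c ])
      (trans (cong₂ _+_ (occ-L c v) (occ-same c [])) (+-comm (length v) 1))
    |V|≡ : suc (occ (opp c) v) < occ (opp c) u → length V ≡ length (take (length V) Z)
    |V|≡ unbalanced = sym (trans (length-take (length V) Z) (m≤n⇒m⊓n≡m (s≤s⁻¹ (begin
      suc (length V)                         ≡⟨ cong suc (trans (length-++ ((L c *) v)) (+-comm _ 1)) ⟩
      2 + length ((L c *) v)                 ≡⟨ cong (2 +_) (length-L c v) ⟩
      2 + (length v + occ (opp c) v)         ≡⟨ sym (trans (+-suc (length v) _) (cong suc (+-suc (length v) _))) ⟩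
      length v + (2 + occ (opp c) v)         ≤⟨ +-mono-≤ (≤-reflexive (sym |u|≡|v|)) unbalanced ⟩
      length u + occ (opp c) u               ≡⟨ sym (length-L c u) ⟩
      suc (length Z)                         ∎))))

-- Factors of the image of an infinite word

-- The language of factors of f(T), for T occurring in w from position N on.
-- The double negation is harmless, as balance is decidable, and it makes
-- recurrence statements about w available constructively.
Image : Morphism → InfWord → ℕ → Word → Set
Image f w N u = ¬ ¬ (∃[ m ] ∃[ P ] ∃[ T ] N ≤ length P × prefix w m ≡ P ++ T × u ⊑ (f *) T)

image-factorial : ∀ f w N → Factorial (Image f w N)
image-factorial f w N u⊑v Fv k = Fv λ (m , P , T , N≤ , eq , v⊑) →
  k (m , P , T , N≤ , eq , ⊑-trans u⊑v v⊑)

NonErasing : Morphism → Set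
NonErasing f = ∀ c → f c ≢ []

_∘ₘ_≗ₘ_ : Morphism → Morphism → Morphism → Set
h ∘ₘ g ≗ₘ f = ∀ c → (h *) (g c) ≡ f c

*-∘ : ∀ {h g f} → h ∘ₘ g ≗ₘ f → ∀ u → (h *) ((g *) u) ≡ (f *) u
*-∘ eq []      = refl
*-∘ {h} {g} eq (c ∷ u) = trans (concatMap-++ h (g c) _) (cong₂ _++_ (eq c) (*-∘ {h} {g} eq u))

L-head : ∀ c {u} → u ≢ [] → ∃[ t ] (L c *) u ≡ c ∷ t
L-head c {[]}    u≢[] = contradiction refl u≢[]
L-head c {e ∷ u} _    = _ , refl

R-last : ∀ c {u} → u ≢ [] → ∃[ t ] (R c *) u ≡ t ++ [ c ]
R-last c {u} u≢[] with initLast u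
... | []      = contradiction refl u≢[]
... | v ∷ʳ′ e = (R c *) v ++ mark c e , (begin
  (R c *) (v ++ [ e ])                       ≡⟨ concatMap-++ (R c) v [ e ] ⟩
  (R c *) v ++ (mark c e ++ [ c ]) ++ []     ≡⟨ cong ((R c *) v ++_) (++-identityʳ _) ⟩
  (R c *) v ++ mark c e ++ [ c ]             ≡⟨ sym (++-assoc ((R c *) v) _ _) ⟩
  ((R c *) v ++ mark c e) ++ [ c ]           ∎)
  where open ≡-Reasoning

-- Appending the next letter `w m` to T guarantees that something nonempty follows u in the image
-- under g. The image of that remainder under L_c begins with the required c.
image-L : ∀ c {f g} w N → NonErasing g → L c ∘ₘ g ≗ₘ f →
          ∀ {u} → Image g w (suc N) u → Image f w N ((L c *) u ++ [ c ])
image-L c {f} {g} w N ne comp {u} Gu k = Gu λ (m , P , T , N< , eq , ⟨ p , q , eq′ ⟩) →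
  let h = (L c) *
      z = g (w m) ++ []
      (t , t≡) = L-head c {q ++ z} (λ e → ne (w m) (++-conicalˡ _ [] (++-conicalʳ q z e)))
  in k (suc m , P , T ++ [ w m ] , <⇒≤ N< ,
    trans (sym (applyUpTo-∷ʳ w m)) (trans (cong (_++ [ w m ]) eq) (++-assoc P T _)) ,
    ⟨ h p , t , (begin
      h p ++ (h u ++ [ c ]) ++ t        ≡⟨ cong (h p ++_) (++-assoc (h u) [ c ] t) ⟩
      h p ++ h u ++ c ∷ t               ≡⟨ cong (λ s → h p ++ h u ++ s) (sym t≡) ⟩
      h p ++ h u ++ h (q ++ z)          ≡⟨ cong (h p ++_) (sym (concatMap-++ (L c) u _)) ⟩
      h p ++ h (u ++ q ++ z)            ≡⟨ sym (concatMap-++ (L c) p _) ⟩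
      h (p ++ u ++ q ++ z)              ≡⟨ cong (λ s → h (p ++ s)) (sym (++-assoc u q z)) ⟩
      h (p ++ (u ++ q) ++ z)            ≡⟨ cong h (sym (++-assoc p (u ++ q) z)) ⟩
      h ((p ++ u ++ q) ++ z)            ≡⟨ cong (λ s → h (s ++ z)) eq′ ⟩
      h ((g *) T ++ z)                  ≡⟨ cong h (sym (concatMap-++ g T [ w m ])) ⟩
      h ((g *) (T ++ [ w m ]))          ≡⟨ *-∘ {L c} {g} comp (T ++ [ w m ]) ⟩
      (f *) (T ++ [ w m ])              ∎) ⟩)
  where open ≡-Reasoning

-- By `L-R` the word is also c followed by R_c(u), and this c ends the image of whatever precedes u.
-- To have something there, the last letter of P is moved into T, so the bound falls from `suc N` to
-- `N`.
image-R : ∀ c {f g} w N → NonErasing g → R c ∘ₘ g ≗ₘ f →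
          ∀ {u} → Image g w (suc N) u → Image f w N ((L c *) u ++ [ c ])
image-R c {f} {g} w N ne comp {u} Gu k = Gu λ (m , P , T , N< , eq , uT) → shift m P T N< eq uT (initLast P)
  where
  open ≡-Reasoning
  h = (R c) *
  shift : ∀ m P T → N < length P → prefix w m ≡ P ++ T → u ⊑ (g *) T → InitLast P → ⊥
  shift m _ T () _ _ []
  shift m _ T N< eq ⟨ p , q , eq′ ⟩ (P ∷ʳ′ e) =
    let (t , t≡) = R-last c {g e ++ p} (λ e≡ → ne e (++-conicalˡ _ p e≡))
    in k (m , P , e ∷ T ,
      s≤s⁻¹ (≤-trans N< (≤-reflexive (trans (length-++ P) (+-comm (length P) 1)))) ,
      trans eq (++-assoc P [ e ] T) ,
      ⟨ t , h q , (begin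
        t ++ ((L c *) u ++ [ c ]) ++ h q      ≡⟨ cong (λ s → t ++ s ++ h q) (L-R c u) ⟩
        t ++ c ∷ h u ++ h q                   ≡⟨ sym (++-assoc t [ c ] _) ⟩
        (t ++ [ c ]) ++ h u ++ h q            ≡⟨ cong₂ _++_ (sym t≡) (sym (concatMap-++ (R c) u q)) ⟩
        h (g e ++ p) ++ h (u ++ q)            ≡⟨ sym (concatMap-++ (R c) (g e ++ p) _) ⟩
        h ((g e ++ p) ++ u ++ q)              ≡⟨ cong h (++-assoc (g e) p _) ⟩
        h (g e ++ p ++ u ++ q)                ≡⟨ cong (λ s → h (g e ++ s)) eq′ ⟩
        h (g e ++ (g *) T)                    ≡⟨ *-∘ {R c} {g} comp (e ∷ T) ⟩
        (f *) (e ∷ T)                         ∎) ⟩)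

prefix-++ˡ : ∀ {v} u q → (u ++ q) IsPrefixOf v → u IsPrefixOf v
prefix-++ˡ []      q eq = refl
prefix-++ˡ (c ∷ u) q eq = cong₂ _∷_ (∷-injectiveˡ eq) (prefix-++ˡ u q (∷-injectiveʳ eq))

factor-of-prefix : ∀ {v} p u q → (p ++ u ++ q) IsPrefixOf v → factor v (length p) (length u) ≡ u
factor-of-prefix []      u q eq = prefix-++ˡ u q eq
factor-of-prefix (c ∷ p) u q eq = factor-of-prefix p u q (∷-injectiveʳ eq)

image-occurs : ∀ {f w v} → f [ w ]≈ v → ∀ {u} → Image f w 0 u → ¬ ¬ (∃[ i ] factor v i (length u) ≡ u)
image-occurs {f} {w} {v} (pre , _) {u} Fu k = Fu λ (m , P , T , _ , eq , ⟨ p , q , eq′ ⟩) →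
  k (length ((f *) P ++ p) , factor-of-prefix ((f *) P ++ p) u q (subst (_IsPrefixOf v) (begin
    (f *) (prefix w m)              ≡⟨ cong (f *) eq ⟩
    (f *) (P ++ T)                  ≡⟨ concatMap-++ f P T ⟩
    (f *) P ++ (f *) T              ≡⟨ cong ((f *) P ++_) (sym eq′) ⟩
    (f *) P ++ p ++ u ++ q          ≡⟨ sym (++-assoc ((f *) P) p _) ⟩
    ((f *) P ++ p) ++ u ++ q        ∎) (pre m)))
  where open ≡-Reasoning

image-balanced : ∀ {f w v} → f [ w ]≈ v → Balanced v → BalancedLanguage (Image f w 0)
image-balanced {f} {w} {v} fw≈v bal = balanced-from-letter {Image f w 0} a λ u u′ Fu Fu′ |u|≡|u′| →
  decidable-stable (_ ≤? _) λ k →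
    image-occurs {f} {w} {v} fw≈v Fu λ (i , i≡) → image-occurs {f} {w} {v} fw≈v Fu′ λ (j , j≡) →
    k (≤-trans (m≤n+∣m-n∣ (occ a u) (occ a u′)) (≤-trans (+-monoʳ-≤ (occ a u′)
      (subst₂ (λ x y → ∣ occ a x - occ a y ∣ ≤ 1) i≡ (trans (cong (factor v j) |u|≡|u′|) j≡) (bal i j (length u))))
      (≤-reflexive (+-comm _ 1))))

-- Factorising a pair of words through L_c or R_c

L-same : ∀ c u → (L c *) (c ∷ u) ≡ c ∷ (L c *) u
L-same a _ = refl
L-same b _ = refl

L-opp : ∀ c u → (L c *) (opp c ∷ u) ≡ c ∷ opp c ∷ (L c *) u
L-opp a _ = refl
L-opp b _ = refl

R-same : ∀ c u → (R c *) (c ∷ u) ≡ c ∷ (R c *) u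
R-same a _ = refl
R-same b _ = refl

R-opp : ∀ c u → (R c *) (opp c ∷ u) ≡ opp c ∷ c ∷ (R c *) u
R-opp a _ = refl
R-opp b _ = refl

-- With d = `opp c`, a word that begins with c and avoids dd is a product of blocks c and cd, which
-- are the images of the letters.
decode-L : ∀ c u → (∃[ z ] (L c *) z ≡ c ∷ u) ⊎ (opp c ∷ opp c ∷ []) ⊑ (c ∷ u)
decode-L c [] = inj₁ ([ c ] , L-same c [])
decode-L c (e ∷ u) with ≡⊎≡opp c e
decode-L c (e ∷ u) | inj₁ refl with decode-L c u
... | inj₁ (z , eq) = inj₁ (c ∷ z , trans (L-same c z) (cong (c ∷_) eq))
... | inj₂ sq       = inj₂ (⊑-++ˡ [ c ] sq)
decode-L c (e ∷ []) | inj₂ refl = inj₁ ([ opp c ] , L-opp c [])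
decode-L c (e ∷ e′ ∷ u) | inj₂ refl with ≡⊎≡opp c e′
... | inj₂ refl = inj₂ ⟨ [ c ] , u , refl ⟩
... | inj₁ refl with decode-L c u
...   | inj₁ (z , eq) = inj₁ (opp c ∷ z , trans (L-opp c z) (cong (λ s → c ∷ opp c ∷ s) eq))
...   | inj₂ sq       = inj₂ (⊑-++ˡ (c ∷ opp c ∷ []) sq)

decode-R : ∀ c u → (∃[ z ] (R c *) z ≡ u ++ [ c ]) ⊎ (opp c ∷ opp c ∷ []) ⊑ (u ++ [ c ])
decode-R c [] = inj₁ ([ c ] , R-same c [])
decode-R c (e ∷ u) with ≡⊎≡opp c e
decode-R c (e ∷ u) | inj₁ refl with decode-R c u
... | inj₁ (z , eq) = inj₁ (c ∷ z , trans (R-same c z) (cong (c ∷_) eq))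
... | inj₂ sq       = inj₂ (⊑-++ˡ [ c ] sq)
decode-R c (e ∷ []) | inj₂ refl = inj₁ ([ opp c ] , R-opp c [])
decode-R c (e ∷ e′ ∷ u) | inj₂ refl with ≡⊎≡opp c e′
... | inj₂ refl = inj₂ ⟨ [] , u ++ [ c ] , refl ⟩
... | inj₁ refl with decode-R c u
...   | inj₁ (z , eq) = inj₁ (opp c ∷ z , trans (R-opp c z) (cong (λ s → opp c ∷ c ∷ s) eq))
...   | inj₂ sq       = inj₂ (⊑-++ˡ (opp c ∷ c ∷ []) sq)

data Factorisation (x y : Word) : Set where
  letters : ∀ c → x ≡ [ c ] → y ≡ [ opp c ] → Factorisation x y
  left    : ∀ c z z′ → (L c *) z ≡ x → (L c *) z′ ≡ y → Factorisation x y
  right   : ∀ c z z′ → (R c *) z ≡ x → (R c *) z′ ≡ y → Factorisation x y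

nonempty-head : ∀ {u : Word} → u ≢ [] → ∃[ c ] ∃[ t ] u ≡ c ∷ t
nonempty-head {[]}    u≢[] = contradiction refl u≢[]
nonempty-head {c ∷ t} _    = c , t , refl

nonempty-last : ∀ {u : Word} → u ≢ [] → ∃[ t ] ∃[ c ] u ≡ t ++ [ c ]
nonempty-last {u} u≢[] with initLast u
... | []      = contradiction refl u≢[]
... | t ∷ʳ′ c = t , c , refl

junction : ∀ {x y t e c s} → x ≡ t ++ [ e ] → y ≡ c ∷ s → (e ∷ c ∷ []) ⊑ (x ++ y)
junction {t = t} {e} {c} {s} refl refl = ⟨ t , s , sym (++-assoc t [ e ] (c ∷ s)) ⟩

-- F and G play the roles of the languages of f(w) for w rich in a, respectively
-- in b, where x = f(a) and y = f(b).
module _ {F G : Word → Set}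
  (facF : Factorial F) (balF : BalancedLanguage F)
  (facG : Factorial G) (balG : BalancedLanguage G) {x y : Word}
  (Fxxx : F (x ++ x ++ x)) (Fxyx : F (x ++ y ++ x))
  (Gyyy : G (y ++ y ++ y)) (Gyxy : G (y ++ x ++ y)) where

  Fxx : F (x ++ x)
  Fxx = facF (⊑-++ˡ x ⊑-refl) Fxxx

  Fxy : F (x ++ y)
  Fxy = facF ⟨ [] , x , ++-assoc x y x ⟩ Fxyx

  Fyx : F (y ++ x)
  Fyx = facF (⊑-++ˡ x ⊑-refl) Fxyx

  Gyy : G (y ++ y)
  Gyy = facG (⊑-++ˡ y ⊑-refl) Gyyy

  -- Let d = `opp c`. If x or y contains dd, then cc is excluded; the junctions in xx and yx show
  -- that neither word ends in c, so both end in d and decode for R_d. Otherwise both decode for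
  -- L_c.
  factorise-common-head : ∀ {c s s′ t e t′ e′} → x ≡ c ∷ s → y ≡ c ∷ s′ →
    x ≡ t ++ [ e ] → y ≡ t′ ++ [ e′ ] → Factorisation x y
  factorise-common-head {c} {s} {s′} {t} {e} {t′} {e′} x≡ y≡ x≡′ y≡′ = decoded (decode-L c s) (decode-L c s′)
    where
    x⊑ : ∀ {u} → u ⊑ x → F u
    x⊑ u⊑x = facF (⊑-++ʳ x u⊑x) Fxx
    y⊑ : ∀ {u} → u ⊑ y → F u
    y⊑ u⊑y = facF (⊑-++ʳ x u⊑y) Fyx
    ends-in-opp : F (opp c ∷ opp c ∷ []) → Factorisation x y
    ends-in-opp Fdd with ≡⊎≡opp c e | ≡⊎≡opp c e′
    ... | inj₁ refl | _         = contradiction Fdd (no-two-squares balF c (facF (junction x≡′ x≡) Fxx))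
    ... | inj₂ refl | inj₁ refl = contradiction Fdd (no-two-squares balF c (facF (junction y≡′ x≡) Fyx))
    ... | inj₂ refl | inj₂ refl with decode-R (opp c) t | decode-R (opp c) t′
    ...   | inj₁ (z , eq) | inj₁ (z′ , eq′) = right (opp c) z z′ (trans eq (sym x≡′)) (trans eq′ (sym y≡′))
    ...   | inj₂ sq | _       = contradiction (x⊑ (subst (_ ⊑_) (sym x≡′) sq)) (no-two-squares balF (opp c) Fdd)
    ...   | inj₁ _  | inj₂ sq = contradiction (y⊑ (subst (_ ⊑_) (sym y≡′) sq)) (no-two-squares balF (opp c) Fdd)
    decoded : (∃[ z ] (L c *) z ≡ c ∷ s) ⊎ (opp c ∷ opp c ∷ []) ⊑ (c ∷ s) →
              (∃[ z ] (L c *) z ≡ c ∷ s′) ⊎ (opp c ∷ opp c ∷ []) ⊑ (c ∷ s′) → Factorisation x y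
    decoded (inj₁ (z , eq)) (inj₁ (z′ , eq′)) = left c z z′ (trans eq (sym x≡)) (trans eq′ (sym y≡))
    decoded (inj₂ sq) _        = ends-in-opp (x⊑ (subst (_ ⊑_) (sym x≡) sq))
    decoded (inj₁ _) (inj₂ sq) = ends-in-opp (y⊑ (subst (_ ⊑_) (sym y≡) sq))

  -- One of x, y begins with `e` and both end in it, so ee occurs at the junction of xx or xy and
  -- the square of the other letter is excluded.
  factorise-common-last : ∀ {c s s′ t e t′} → x ≡ c ∷ s → y ≡ opp c ∷ s′ →
    x ≡ t ++ [ e ] → y ≡ t′ ++ [ e ] → Factorisation x y
  factorise-common-last {c} {s} {s′} {t} {e} {t′} x≡ y≡ x≡′ y≡′ with decode-R e t | decode-R e t′
  ... | inj₁ (z , eq) | inj₁ (z′ , eq′) = right e z z′ (trans eq (sym x≡′)) (trans eq′ (sym y≡′))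
  ... | inj₂ sq | _ = contradiction (facF (⊑-++ʳ x (subst (_ ⊑_) (sym x≡′) sq)) Fxx) (no-two-squares balF e ee)
    where
    ee : F (e ∷ e ∷ [])
    ee with ≡⊎≡opp c e
    ... | inj₁ refl = facF (junction x≡′ x≡) Fxx
    ... | inj₂ refl = facF (junction x≡′ y≡) Fxy
  ... | inj₁ _ | inj₂ sq = contradiction (facF (⊑-++ʳ x (subst (_ ⊑_) (sym y≡′) sq)) Fyx) (no-two-squares balF e ee)
    where
    ee : F (e ∷ e ∷ [])
    ee with ≡⊎≡opp c e
    ... | inj₁ refl = facF (junction x≡′ x≡) Fxx
    ... | inj₂ refl = facF (junction x≡′ y≡) Fxy

  -- cxc is a factor of xxx, and the word sdcd of the same length, with two
  -- fewer letters c, is a factor of xyx.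
  no-alternating-prefix : ∀ {c s t r} → x ≡ c ∷ s → x ≡ t ++ [ c ] → y ++ x ≢ opp c ∷ c ∷ opp c ∷ r
  no-alternating-prefix {c} {s} {t} {r} x≡ x≡′ yx≡ = <⇒≱ (n<1+n (2 + occ c s)) (begin
    3 + occ c s                           ≡⟨ sym occ-cxc ⟩
    occ c (c ∷ x ++ [ c ])                ≤⟨ balF _ _ (facF cxc⊑xxx Fxxx) (facF sdcd⊑xyx Fxyx) lengths c ⟩
    suc (occ c (s ++ opp c ∷ c ∷ opp c ∷ []))    ≡⟨ cong suc occ-sdcd ⟩
    2 + occ c s                           ∎)
    where
    open ≤-Reasoning
    cxc⊑xxx : (c ∷ x ++ [ c ]) ⊑ (x ++ x ++ x)
    cxc⊑xxx = ⟨ t , s , trans (cong (λ u → t ++ c ∷ u) (++-assoc x [ c ] s))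
      (trans (sym (++-assoc t [ c ] _)) (cong₂ (λ u v → u ++ x ++ v) (sym x≡′) (sym x≡))) ⟩
    sdcd⊑xyx : (s ++ opp c ∷ c ∷ opp c ∷ []) ⊑ (x ++ y ++ x)
    sdcd⊑xyx = ⟨ [ c ] , r , trans (cong (c ∷_) (++-assoc s _ r)) (cong₂ _++_ (sym x≡) (sym yx≡)) ⟩
    occ-cxc : occ c (c ∷ x ++ [ c ]) ≡ 3 + occ c s
    occ-cxc rewrite x≡ | occ-same c (c ∷ s ++ [ c ]) | occ-same c (s ++ [ c ]) | occ-++ c s [ c ]
      | occ-same c [] = cong (2 +_) (+-comm (occ c s) 1)
    occ-sdcd : occ c (s ++ opp c ∷ c ∷ opp c ∷ []) ≡ 1 + occ c s
    occ-sdcd rewrite occ-++ c s (opp c ∷ c ∷ opp c ∷ []) | occ-opp c (c ∷ opp c ∷ []) | occ-same c (opp c ∷ [])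
      | occ-opp c [] = +-comm (occ c s) 1
    lengths : length (c ∷ x ++ [ c ]) ≡ length (s ++ opp c ∷ c ∷ opp c ∷ [])
    lengths rewrite x≡ | length-++ s {[ c ]} | length-++ s {opp c ∷ c ∷ opp c ∷ []} =
      trans (cong (2 +_) (+-comm (length s) 1)) (+-comm 3 (length s))

  -- With d = `opp c`, F contains cc (in xx) and G contains dd (in yy), so F has no dd and G no cc.
  -- Unless x and y are single letters, this forces yx to begin with dcd, against
  -- `no-alternating-prefix`.
  factorise-bordered : ∀ {c s s′ t t′} → x ≡ c ∷ s → y ≡ opp c ∷ s′ →
    x ≡ t ++ [ c ] → y ≡ t′ ++ [ opp c ] → Factorisation x y
  factorise-bordered {c} {s} {s′} {t} {t′} x≡ y≡ x≡′ y≡′ = by-shape s s′ x≡ y≡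
    where
    Fcc : F (c ∷ c ∷ [])
    Fcc = facF (junction x≡′ x≡) Fxx
    Gdd : G (opp c ∷ opp c ∷ [])
    Gdd = facG (junction y≡′ y≡) Gyy
    last-unique : ∀ t → opp c ∷ c ∷ [] ≢ t ++ [ opp c ]
    last-unique []          ()
    last-unique (_ ∷ [])    eq = c≢opp c (∷-injectiveˡ (∷-injectiveʳ eq))
    last-unique (_ ∷ _ ∷ t) eq with ++-conicalʳ t _ (sym (∷-injectiveʳ (∷-injectiveʳ eq)))
    ... | ()
    by-shape : ∀ s s′ → x ≡ c ∷ s → y ≡ opp c ∷ s′ → Factorisation x y
    by-shape []      []      x≡ y≡ = letters c x≡ y≡
    by-shape (e ∷ s) []      x≡ y≡ with ≡⊎≡opp c e
    ... | inj₁ refl = contradiction Gdd (no-two-squares balG c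
      (facG (⊑-++ˡ y (⊑-++ʳ y ⟨ [] , s , sym x≡ ⟩)) Gyxy))
    ... | inj₂ refl = contradiction (cong₂ _++_ y≡ x≡) (no-alternating-prefix x≡ x≡′)
    by-shape s (e ∷ s′) x≡ y≡ with ≡⊎≡opp c e
    by-shape s (e ∷ s′) x≡ y≡ | inj₂ refl =
      contradiction (facF (⊑-++ʳ x ⟨ [] , s′ , sym y≡ ⟩) Fyx) (no-two-squares balF c Fcc)
    by-shape s (e ∷ []) x≡ y≡ | inj₁ refl = contradiction (trans (sym y≡) y≡′) (last-unique t′)
    by-shape s (e ∷ e′ ∷ s′) x≡ y≡ | inj₁ refl with ≡⊎≡opp c e′
    ... | inj₁ refl = contradiction Gdd (no-two-squares balG c
      (facG (⊑-++ʳ y ⟨ [ opp c ] , s′ , sym y≡ ⟩) Gyy))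
    ... | inj₂ refl = contradiction (cong (_++ x) y≡) (no-alternating-prefix x≡ x≡′)

  factorise : x ≢ [] → y ≢ [] → Factorisation x y
  factorise x≢[] y≢[] = by-borders (nonempty-head x≢[]) (nonempty-head y≢[]) (nonempty-last x≢[]) (nonempty-last y≢[])
    where
    by-borders : ∃[ c ] ∃[ s ] x ≡ c ∷ s → ∃[ c′ ] ∃[ s′ ] y ≡ c′ ∷ s′ →
                 ∃[ t ] ∃[ e ] x ≡ t ++ [ e ] → ∃[ t′ ] ∃[ e′ ] y ≡ t′ ++ [ e′ ] → Factorisation x y
    by-borders (c , _ , x≡) (c′ , _ , y≡) (_ , e , x≡′) (_ , e′ , y≡′) with ≡⊎≡opp c c′
    ... | inj₁ refl = factorise-common-head x≡ y≡ x≡′ y≡′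
    ... | inj₂ refl with ≡⊎≡opp c e | ≡⊎≡opp c e′
    ...   | inj₁ refl | inj₁ refl = factorise-common-last x≡ y≡ x≡′ y≡′
    ...   | inj₂ refl | inj₂ refl = factorise-common-last x≡ y≡ x≡′ y≡′
    ...   | inj₁ refl | inj₂ refl = factorise-bordered x≡ y≡ x≡′ y≡′
    -- Here x leads from c to d = `opp c` and y from d to c, so xy has dd and yx has cc at its
    -- junction.
    ...   | inj₂ refl | inj₁ refl = contradiction (facF (junction x≡′ y≡) Fxy)
      (no-two-squares balF c (facF (junction y≡′ x≡) Fyx))

-- Patterns and balance in the images of the mechanical words

prefix-+3 : ∀ w n → prefix w (3 + n) ≡ prefix w n ++ w n ∷ w (1 + n) ∷ w (2 + n) ∷ []
prefix-+3 w n = begin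
  prefix w (3 + n)                                               ≡⟨ sym (applyUpTo-∷ʳ w (2 + n)) ⟩
  prefix w (2 + n) ++ [ w (2 + n) ]                              ≡⟨ cong (_++ [ w (2 + n) ]) (sym (applyUpTo-∷ʳ w (1 + n))) ⟩
  (prefix w (1 + n) ++ [ w (1 + n) ]) ++ [ w (2 + n) ]           ≡⟨ ++-assoc (prefix w (1 + n)) _ _ ⟩
  prefix w (1 + n) ++ w (1 + n) ∷ w (2 + n) ∷ []                 ≡⟨ cong (_++ (w (1 + n) ∷ w (2 + n) ∷ [])) (sym (applyUpTo-∷ʳ w n)) ⟩
  (prefix w n ++ [ w n ]) ++ w (1 + n) ∷ w (2 + n) ∷ []          ≡⟨ ++-assoc (prefix w n) _ _ ⟩
  prefix w n ++ w n ∷ w (1 + n) ∷ w (2 + n) ∷ []                 ∎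
  where open ≡-Reasoning

image-of-three : ∀ f w N {n c d e} → N ≤ n → w n ≡ c → w (1 + n) ≡ d → w (2 + n) ≡ e →
                 Image f w N (f c ++ f d ++ f e)
image-of-three f w N {n} {c} {d} {e} N≤n refl refl refl k = k
  ( 3 + n , prefix w n , _
  , ≤-trans N≤n (≤-reflexive (sym (length-applyUpTo w n)))
  , prefix-+3 w n
  , ⟨ [] , [] , trans (++-assoc (f c) _ []) (cong (f c ++_) (++-assoc (f d) (f e) [])) ⟩)

image-cube : ∀ f c N → Image f (mechanical c) N (f c ++ f c ++ f c)
image-cube f c N k = flat-run-recurs N λ (n , N≤n , (_ , p) , (_ , q) , (_ , r)) →
  image-of-three f (mechanical c) N N≤n (p c) (q c) (r c) k

image-isolated : ∀ f c N → Image f (mechanical c) N (f c ++ f (opp c) ++ f c)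
image-isolated f c N k = isolated-jump-recurs N λ (n , N≤n , (_ , p) , (_ , q) , (_ , r)) →
  image-of-three f (mechanical c) N N≤n (p c) (q c) (r c) k

-- `N` grows by one whenever a factor L_c or R_c is removed.
record BalancedFrom (N : ℕ) (f : Morphism) : Set where
  constructor balancedFrom
  field balanced-image : ∀ c → BalancedLanguage (Image f (mechanical c) N)

factorise-balanced : ∀ {f N} → NonErasing f → BalancedFrom N f → Factorisation (f a) (f b)
factorise-balanced {f} {N} ne (balancedFrom bal) = factorise
  (image-factorial f (mechanical a) N) (bal a) (image-factorial f (mechanical b) N) (bal b)
  (image-cube f a N) (image-isolated f a N) (image-cube f b N) (image-isolated f b N) (ne a) (ne b)

balanced-from-L : ∀ c {f g N} → NonErasing g → L c ∘ₘ g ≗ₘ f → BalancedFrom N f → BalancedFrom (suc N) g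
balanced-from-L c {f} {g} {N} ne comp (balancedFrom bal) = balancedFrom λ e → balanced-reflect c
  (image-factorial f (mechanical e) N) (bal e) (image-L c (mechanical e) N ne comp)

balanced-from-R : ∀ c {f g N} → NonErasing g → R c ∘ₘ g ≗ₘ f → BalancedFrom N f → BalancedFrom (suc N) g
balanced-from-R c {f} {g} {N} ne comp (balancedFrom bal) = balancedFrom λ e → balanced-reflect c
  (image-factorial f (mechanical e) N) (bal e) (image-R c (mechanical e) N ne comp)

-- Induction: one image is a prefix or a suffix of the other

Related : Morphism → Set
Related f = ∃[ c ] ∃[ z ] (f (opp c) ≡ f c ++ z ⊎ f (opp c) ≡ z ++ f c)

LetterMap : Morphism → Set
LetterMap f = ∃[ c ] f a ≡ [ c ] × f b ≡ [ opp c ]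

related-∘ : ∀ h {g f} → h ∘ₘ g ≗ₘ f → Related g → Related f
related-∘ h {g} comp (c , z , inj₁ eq) = c , (h *) z , inj₁ (trans (sym (comp (opp c)))
  (trans (cong (h *) eq) (trans (concatMap-++ h (g c) z) (cong (_++ (h *) z) (comp c)))))
related-∘ h {g} comp (c , z , inj₂ eq) = c , (h *) z , inj₂ (trans (sym (comp (opp c)))
  (trans (cong (h *) eq) (trans (concatMap-++ h z (g c)) (cong ((h *) z ++_) (comp c)))))

L-related : ∀ c → Related (L c)
L-related a = a , [ b ] , inj₁ refl
L-related b = b , [ a ] , inj₁ refl

R-related : ∀ c → Related (R c)
R-related a = a , [ b ] , inj₂ refl
R-related b = b , [ a ] , inj₂ refl

-- Here f is `h` or `h` composed with `E`; in the second case the distinguished letter of `Related`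
-- is exchanged.
related-∘-letters : ∀ h {g f} → h ∘ₘ g ≗ₘ f → LetterMap g → Related h → Related f
related-∘-letters h {g} {f} comp (c , ga , gb) rel = transport c ga gb rel
  where
  image : ∀ {e e′} → g e ≡ [ e′ ] → f e ≡ h e′
  image {e} {e′} eq = trans (sym (comp e)) (trans (cong (h *) eq) (++-identityʳ (h e′)))
  transport : ∀ c → g a ≡ [ c ] → g b ≡ [ opp c ] → Related h → Related f
  transport a ga gb (a , z , r) rewrite sym (image ga) | sym (image gb) = a , z , r
  transport a ga gb (b , z , r) rewrite sym (image ga) | sym (image gb) = b , z , r
  transport b ga gb (a , z , r) rewrite sym (image ga) | sym (image gb) = b , z , r
  transport b ga gb (b , z , r) rewrite sym (image ga) | sym (image gb) = a , z , r

occ-opp≡0 : ∀ c u → occ (opp c) u ≡ 0 → u ≡ replicate (length u) c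
occ-opp≡0 c []      _  = refl
occ-opp≡0 c (e ∷ u) eq with ≡⊎≡opp c e
... | inj₁ refl = cong (c ∷_) (occ-opp≡0 c u (trans (sym (opp-occ c u)) eq))
... | inj₂ refl = contradiction (trans (sym (occ-same (opp c) u)) eq) λ ()

replicate-split : ∀ {m n} (c : Letter) → m ≤ n → replicate n c ≡ replicate m c ++ replicate (n ∸ m) c
replicate-split c z≤n       = refl
replicate-split c (s≤s m≤n) = cong (c ∷_) (replicate-split c m≤n)

powers-related : ∀ c {g} → occ (opp c) (g a) ≡ 0 → occ (opp c) (g b) ≡ 0 → Related g
powers-related c {g} ga gb with ≤-total (length (g a)) (length (g b))
... | inj₁ le = a , _ , inj₁ (trans (occ-opp≡0 c (g b) gb) (trans (replicate-split c le)
  (cong (_++ replicate (length (g b) ∸ length (g a)) c) (sym (occ-opp≡0 c (g a) ga)))))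
... | inj₂ le = b , _ , inj₁ (trans (occ-opp≡0 c (g a) ga) (trans (replicate-split c le)
  (cong (_++ replicate (length (g a) ∸ length (g b)) c) (sym (occ-opp≡0 c (g b) gb)))))

pair : Word → Word → Morphism
pair x y a = x
pair x y b = y

∘ₘ-nonErasing : ∀ h {g f} → h ∘ₘ g ≗ₘ f → NonErasing f → NonErasing g
∘ₘ-nonErasing h comp ne c gc≡[] = ne c (trans (sym (comp c)) (cong (h *) gc≡[]))

∥_∥ : Morphism → ℕ
∥ f ∥ = length (f a) + length (f b)

∥∥-∘ : ∀ c h {g f} → (∀ u → length ((h *) u) ≡ length u + occ (opp c) u) → h ∘ₘ g ≗ₘ f →
       ∥ f ∥ ≡ ∥ g ∥ + (occ (opp c) (g a) + occ (opp c) (g b))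
∥∥-∘ c h {g} {f} len comp = begin
  length (f a) + length (f b)                      ≡⟨ cong₂ (λ x y → length x + length y) (sym (comp a)) (sym (comp b)) ⟩
  length ((h *) (g a)) + length ((h *) (g b))      ≡⟨ cong₂ _+_ (len (g a)) (len (g b)) ⟩
  (length (g a) + occ (opp c) (g a)) + (length (g b) + occ (opp c) (g b))    ≡⟨ interchange (length (g a)) _ _ _ ⟩
  ∥ g ∥ + (occ (opp c) (g a) + occ (opp c) (g b))  ∎
  where
  open ≡-Reasoning
  interchange : ∀ w x y z → (w + x) + (y + z) ≡ (w + y) + (x + z)
  interchange w x y z = trans (+-assoc w x _) (trans (cong (w +_)
    (trans (sym (+-assoc x y z)) (trans (cong (_+ z) (+-comm x y)) (+-assoc y x z)))) (sym (+-assoc w y _)))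

-- `h` lengthens a word by its number of letters `opp c`, so the induction descends as soon as z or
-- z′ contains one. Otherwise z and z′ are powers of c, and one is a prefix of the other.
related-through : ∀ c h {f} → NonErasing f → Related h →
  (∀ u → length ((h *) u) ≡ length u + occ (opp c) u) →
  (∀ g → NonErasing g → h ∘ₘ g ≗ₘ f → ∥ g ∥ < ∥ f ∥ → LetterMap g ⊎ Related g) →
  ∀ z z′ → (h *) z ≡ f a → (h *) z′ ≡ f b → Related f
related-through c h {f} ne rel len rec z z′ fa fb = by-rare-letters (occ (opp c) z + occ (opp c) z′) refl
  where
  g = pair z z′
  comp : h ∘ₘ g ≗ₘ f
  comp a = fa
  comp b = fb
  by-rare-letters : ∀ m → occ (opp c) z + occ (opp c) z′ ≡ m → Related f
  by-rare-letters zero    eq = related-∘ h {g} comp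
    (powers-related c (m+n≡0⇒m≡0 (occ (opp c) z) eq) (m+n≡0⇒n≡0 (occ (opp c) z) eq))
  by-rare-letters (suc m) eq = conclude (rec g (∘ₘ-nonErasing h {g} comp ne) comp ∥g∥<∥f∥)
    where
    ∥g∥<∥f∥ : ∥ g ∥ < ∥ f ∥
    ∥g∥<∥f∥ = subst (∥ g ∥ <_) (sym (∥∥-∘ c h {g} {f} len comp))
      (m<m+n ∥ g ∥ (subst (0 <_) (sym eq) (s≤s z≤n)))
    conclude : LetterMap g ⊎ Related g → Related f
    conclude (inj₁ lm)   = related-∘-letters h {g} comp lm rel
    conclude (inj₂ rel′) = related-∘ h {g} comp rel′

-- `k` is fuel. `N` is quantified along with `f`, since the recursive call is made at `suc N`.
letterMap⊎related : ∀ k {f N} → ∥ f ∥ < k → NonErasing f → BalancedFrom N f → LetterMap f ⊎ Related f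
letterMap⊎related (suc k) {f} {N} (s≤s ∥f∥≤k) ne bal = split (factorise-balanced ne bal)
  where
  recurse : ∀ g → NonErasing g → BalancedFrom (suc N) g → ∥ g ∥ < ∥ f ∥ → LetterMap g ⊎ Related g
  recurse g ne′ bal′ ∥g∥<∥f∥ = letterMap⊎related k (≤-trans ∥g∥<∥f∥ ∥f∥≤k) ne′ bal′
  split : Factorisation (f a) (f b) → LetterMap f ⊎ Related f
  split (letters c fa fb)    = inj₁ (c , fa , fb)
  split (left c z z′ fa fb)  = inj₂ (related-through c (L c) ne (L-related c) (length-L c)
    (λ g ne′ comp → recurse g ne′ (balanced-from-L c {f} {g} ne′ comp bal)) z z′ fa fb)
  split (right c z z′ fa fb) = inj₂ (related-through c (R c) ne (R-related c) (length-R c)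
    (λ g ne′ comp → recurse g ne′ (balanced-from-R c {f} {g} ne′ comp bal)) z z′ fa fb)

-- Words with a periodic tail

power : Word → ℕ → Word
power y zero    = []
power y (suc n) = y ++ power y n

power-snoc : ∀ y n → power y n ++ y ≡ power y (suc n)
power-snoc y zero    = sym (++-identityʳ y)
power-snoc y (suc n) = trans (++-assoc y (power y n) y) (cong (y ++_) (power-snoc y n))

power-shift : ∀ x z n → power (x ++ z) n ++ x ≡ x ++ power (z ++ x) n
power-shift x z zero    = sym (++-identityʳ x)
power-shift x z (suc n) = begin
  ((x ++ z) ++ power (x ++ z) n) ++ x    ≡⟨ ++-assoc (x ++ z) _ x ⟩
  (x ++ z) ++ power (x ++ z) n ++ x      ≡⟨ cong ((x ++ z) ++_) (power-shift x z n) ⟩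
  (x ++ z) ++ x ++ power (z ++ x) n      ≡⟨ ++-assoc x z _ ⟩
  x ++ z ++ x ++ power (z ++ x) n        ≡⟨ cong (x ++_) (sym (++-assoc z x _)) ⟩
  x ++ (z ++ x) ++ power (z ++ x) n      ∎
  where open ≡-Reasoning

length-power : ∀ y → 0 < length y → ∀ n → n ≤ length (power y n)
length-power y y>0 zero    = z≤n
length-power y y>0 (suc n) = ≤-trans (+-mono-≤ y>0 (length-power y y>0 n)) (≤-reflexive (sym (length-++ y)))

-- The infinite word q y^ω (constantly a after q if y is empty).
mutual
  _▷_^ω : Word → Word → InfWord
  ([]      ▷ y ^ω) n       = (y ^ω) n
  ((c ∷ q) ▷ y ^ω) zero    = c
  ((c ∷ q) ▷ y ^ω) (suc n) = (q ▷ y ^ω) n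

  _^ω : Word → InfWord
  ([] ^ω)      n       = a
  ((c ∷ t) ^ω) zero    = c
  ((c ∷ t) ^ω) (suc n) = (t ▷ (c ∷ t) ^ω) n

▷-prefix : ∀ y q u r k → u ++ r ≡ q ++ power y k → u IsPrefixOf (q ▷ y ^ω)
▷-prefix y       q       []      r k       eq = refl
▷-prefix y       (e ∷ q) (c ∷ u) r k       eq =
  cong₂ _∷_ (sym (∷-injectiveˡ eq)) (▷-prefix y q u r k (∷-injectiveʳ eq))
▷-prefix y       []      (c ∷ u) r zero    ()
▷-prefix []      []      (c ∷ u) r (suc k) eq = ▷-prefix [] [] (c ∷ u) r k eq
▷-prefix (e ∷ t) []      (c ∷ u) r (suc k) eq =
  cong₂ _∷_ (sym (∷-injectiveˡ eq)) (▷-prefix (e ∷ t) t u r k (∷-injectiveʳ eq))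

constant-tail : ∀ d n → ([] ▷ [ d ] ^ω) n ≡ d
constant-tail d zero    = refl
constant-tail d (suc n) = constant-tail d n

prefix-constant : ∀ d n → prefix ([] ▷ [ d ] ^ω) n ≡ power [ d ] n
prefix-constant d zero    = refl
prefix-constant d (suc n) = cong (d ∷_) (prefix-constant d n)

prefix-▷ : ∀ q d n → prefix (q ▷ [ d ] ^ω) (length q + n) ≡ q ++ power [ d ] n
prefix-▷ []      d n = prefix-constant d n
prefix-▷ (c ∷ q) d n = cong (c ∷_) (prefix-▷ q d n)

-- The prefix may stop inside `q`; then `r` supplies the rest of `q`.
prefix-▷-extends : ∀ q d n → ∃[ r ] ∃[ k ] prefix (q ▷ [ d ] ^ω) n ++ r ≡ q ++ power [ d ] k
prefix-▷-extends []      d n       = [] , n , trans (++-identityʳ _) (prefix-constant d n)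
prefix-▷-extends (c ∷ q) d zero    = c ∷ q ++ [] , 0 , refl
prefix-▷-extends (c ∷ q) d (suc n) =
  let (r , k , eq) = prefix-▷-extends q d n in r , k , cong (c ∷_) eq

*-power : ∀ f d k → (f *) (power [ d ] k) ≡ power (f d) k
*-power f d zero    = refl
*-power f d (suc k) = cong (f d ++_) (*-power f d k)

*-▷ : ∀ f q d → 0 < length (f d) → f [ q ▷ [ d ] ^ω ]≈ ((f *) q ▷ f d ^ω)
*-▷ f q d fd>0 = pre , unbounded
  where
  f*-q-power : ∀ k → (f *) (q ++ power [ d ] k) ≡ (f *) q ++ power (f d) k
  f*-q-power k = trans (concatMap-++ f q _) (cong ((f *) q ++_) (*-power f d k))
  pre : ∀ n → (f *) (prefix (q ▷ [ d ] ^ω) n) IsPrefixOf ((f *) q ▷ f d ^ω)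
  pre n with prefix-▷-extends q d n
  ... | r , k , eq = ▷-prefix (f d) ((f *) q) _ ((f *) r) k
    (trans (sym (concatMap-++ f (prefix (q ▷ [ d ] ^ω) n) r)) (trans (cong (f *) eq) (f*-q-power k)))
  unbounded : ∀ m → ∃[ n ] m ≤ length ((f *) (prefix (q ▷ [ d ] ^ω) n))
  unbounded m = length q + m , (begin
    m                                                          ≤⟨ length-power (f d) fd>0 m ⟩
    length (power (f d) m)                                     ≤⟨ m≤n+m _ (length ((f *) q)) ⟩
    length ((f *) q) + length (power (f d) m)                  ≡⟨ sym (length-++ ((f *) q)) ⟩
    length ((f *) q ++ power (f d) m)                          ≡⟨ cong length (sym (trans (cong (f *) (prefix-▷ q d m)) (f*-q-power m))) ⟩
    length ((f *) (prefix (q ▷ [ d ] ^ω) (length q + m)))      ∎)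
    where open ≤-Reasoning

-- Quasiperiodic and non-quasiperiodic words

applyUpTo-injective : ∀ {A : Set} (g h : ℕ → A) n → applyUpTo g n ≡ applyUpTo h n →
                      ∀ k → k < n → g k ≡ h k
applyUpTo-injective g h (suc n) eq zero    _         = ∷-injectiveˡ eq
applyUpTo-injective g h (suc n) eq (suc k) (s≤s k<n) =
  applyUpTo-injective (g ∘ suc) (h ∘ suc) n (∷-injectiveʳ eq) k k<n

-- Compares the first two listed occurrences of the quasiperiod: one at 0, the other at the length
-- of `p 1`.
quasiperiodic-return : ∀ {w} → Quasiperiodic w →
  ∃[ i ] ∃[ n ] 0 < i × i ≤ n × (∀ k → k < n → w (i + k) ≡ w k)
quasiperiodic-return {w} (u , p , p₀ , cover) =
  length (p 1) , length u ,
  subst (λ v → length v < length (p 1)) p₀ (proj₁ (cover 0)) ,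
  subst (λ v → length (p 1) ≤ length v + length u) p₀ (proj₁ (proj₂ (cover 0))) ,
  applyUpTo-injective (λ k → w (length (p 1) + k)) w (length u) (trans
    (factor-of-prefix (p 1) u [] (subst (λ v → (p 1 ++ v) IsPrefixOf w) (sym (++-identityʳ u)) (proj₂ (proj₂ (cover 1)))))
    (sym (subst (λ v → (v ++ u) IsPrefixOf w) p₀ (proj₂ (proj₂ (cover 0))))))

cdω-not-quasiperiodic : ∀ c → ¬ Quasiperiodic ([ c ] ▷ [ opp c ] ^ω)
cdω-not-quasiperiodic c qp with quasiperiodic-return qp
... | suc i , suc n , _ , _ , return = c≢opp c (trans (sym (return 0 (s≤s z≤n))) (constant-tail (opp c) (i + 0)))

-- A return at 1 would equate the first two letters. A return at i ≥ 2 has length at least 2, so the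
-- only c, at position 1, would recur at i + 1.
dcdω-not-quasiperiodic : ∀ c → ¬ Quasiperiodic ((opp c ∷ c ∷ []) ▷ [ opp c ] ^ω)
dcdω-not-quasiperiodic c qp with quasiperiodic-return qp
... | suc zero    , suc n       , _ , _ , return = c≢opp c (return 0 (s≤s z≤n))
... | suc (suc i) , suc zero    , _ , s≤s () , _
... | suc (suc i) , suc (suc n) , _ , _ , return =
  c≢opp c (trans (sym (return 1 (s≤s (s≤s z≤n)))) (constant-tail (opp c) (i + 1)))

-- x(zx)^ω is the periodic word (xz)^ω, tiled by xz without overlaps.
suffix-quasiperiodic : ∀ x z → 0 < length (z ++ x) → Quasiperiodic (x ▷ (z ++ x) ^ω)
suffix-quasiperiodic x z zx>0 = x ++ z , power (x ++ z) , refl , λ n →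
  subst (length (power (x ++ z) n) <_) (sym (length-suc n)) (m<n+m _ xz>0) ,
  ≤-reflexive (trans (length-suc n) (+-comm (length (x ++ z)) _)) ,
  ▷-prefix (z ++ x) x _ x (suc n) (begin
    (power (x ++ z) n ++ x ++ z) ++ x    ≡⟨ cong (_++ x) (power-snoc (x ++ z) n) ⟩
    power (x ++ z) (suc n) ++ x          ≡⟨ power-shift x z (suc n) ⟩
    x ++ power (z ++ x) (suc n)          ∎)
  where
  open ≡-Reasoning
  xz>0 : 0 < length (x ++ z)
  xz>0 = subst (0 <_) (trans (length-++ z) (trans (+-comm (length z) _) (sym (length-++ x)))) zx>0
  length-suc : ∀ n → length (power (x ++ z) (suc n)) ≡ length (x ++ z) + length (power (x ++ z) n)
  length-suc n = length-++ (x ++ z)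

-- With y = xz, the word is yx followed by y^ω, and yy = (yx)z begins with yx. So yx occurs at 0, at
-- |yx|, and then every |y| letters.
prefix-quasiperiodic : ∀ x z → 0 < length (x ++ z) → Quasiperiodic (((x ++ z) ++ x) ▷ (x ++ z) ^ω)
prefix-quasiperiodic x z y>0 = u , p , refl , λ n → increasing n , gap n , covers n
  where
  open ≡-Reasoning
  y = x ++ z
  u = y ++ x
  p : ℕ → Word
  p zero    = []
  p (suc n) = u ++ power y n
  |y|≤|u| : length y ≤ length u
  |y|≤|u| = ≤-trans (m≤m+n (length y) (length x)) (≤-reflexive (sym (length-++ y)))
  length-p : ∀ n → length (p (2 + n)) ≡ length (p (1 + n)) + length y
  length-p n = begin
    length (u ++ power y (suc n))              ≡⟨ cong (λ v → length (u ++ v)) (sym (power-snoc y n)) ⟩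
    length (u ++ power y n ++ y)               ≡⟨ cong length (sym (++-assoc u _ y)) ⟩
    length ((u ++ power y n) ++ y)             ≡⟨ length-++ (u ++ power y n) ⟩
    length (u ++ power y n) + length y         ∎
  length-p₁ : length (p 1) ≡ length u
  length-p₁ = cong length (++-identityʳ u)
  increasing : ∀ n → length (p n) < length (p (suc n))
  increasing zero    = subst (0 <_) (sym length-p₁) (≤-trans y>0 |y|≤|u|)
  increasing (suc n) = subst (length (p (suc n)) <_) (sym (length-p n)) (m<m+n _ y>0)
  gap : ∀ n → length (p (suc n)) ≤ length (p n) + length u
  gap zero    = ≤-reflexive length-p₁
  gap (suc n) = ≤-trans (≤-reflexive (length-p n)) (+-monoʳ-≤ (length (p (suc n))) |y|≤|u|)
  covers : ∀ n → (p n ++ u) IsPrefixOf (u ▷ y ^ω)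
  covers zero    = ▷-prefix y u u [] 0 refl
  covers (suc n) = ▷-prefix y u ((u ++ power y n) ++ u) z (2 + n) (begin
    ((u ++ power y n) ++ u) ++ z             ≡⟨ ++-assoc (u ++ power y n) u z ⟩
    (u ++ power y n) ++ u ++ z               ≡⟨ ++-assoc u (power y n) _ ⟩
    u ++ power y n ++ (y ++ x) ++ z          ≡⟨ cong (λ v → u ++ power y n ++ v) (++-assoc y x z) ⟩
    u ++ power y n ++ y ++ y                 ≡⟨ cong (u ++_) (sym (++-assoc (power y n) y y)) ⟩
    u ++ (power y n ++ y) ++ y               ≡⟨ cong (λ v → u ++ v ++ y) (power-snoc y n) ⟩
    u ++ power y (suc n) ++ y                ≡⟨ cong (u ++_) (power-snoc y (suc n)) ⟩
    u ++ power y (2 + n)                     ∎)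

related-quasiperiodic : ∀ {f} ((c , _) : Related f) → 0 < length (f (opp c)) → QuasiperiodicMorphism f
related-quasiperiodic {f} (c , z , inj₂ eq) fd>0 =
  [ c ] ▷ [ opp c ] ^ω , cdω-not-quasiperiodic c ,
  (f *) [ c ] ▷ f (opp c) ^ω , *-▷ f [ c ] (opp c) fd>0 ,
  subst₂ (λ q y → Quasiperiodic (q ▷ y ^ω)) (sym (++-identityʳ (f c))) (sym eq)
    (suffix-quasiperiodic (f c) z (subst (λ y → 0 < length y) eq fd>0))
related-quasiperiodic {f} (c , z , inj₁ eq) fd>0 =
  (opp c ∷ c ∷ []) ▷ [ opp c ] ^ω , dcdω-not-quasiperiodic c ,
  (f *) (opp c ∷ c ∷ []) ▷ f (opp c) ^ω , *-▷ f (opp c ∷ c ∷ []) (opp c) fd>0 ,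
  subst₂ (λ q y → Quasiperiodic (q ▷ y ^ω))
    (cong₂ _++_ (sym eq) (sym (++-identityʳ (f c)))) (sym eq)
    (prefix-quasiperiodic (f c) z (subst (λ y → 0 < length y) eq fd>0))

-- Erasing morphisms and the conclusion

nonempty-length : ∀ {u : Word} → u ≢ [] → 0 < length u
nonempty-length {[]}    u≢[] = contradiction refl u≢[]
nonempty-length {_ ∷ _} _    = s≤s z≤n

empty? : ∀ (u : Word) → u ≡ [] ⊎ u ≢ []
empty? []      = inj₁ refl
empty? (_ ∷ _) = inj₂ λ ()

-- The empty word is a prefix of every word, so erasing one letter already gives `Related f`.
erasing-quasiperiodic : ∀ {f} c → f c ≡ [] → f (opp c) ≢ [] → QuasiperiodicMorphism f
erasing-quasiperiodic {f} c fc≡[] fd≢[] =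
  related-quasiperiodic (c , f (opp c) , inj₁ (cong (_++ f (opp c)) (sym fc≡[]))) (nonempty-length fd≢[])

erases-all : ∀ {f} → f a ≡ [] → f b ≡ [] → ∀ u → (f *) u ≡ []
erases-all {f} fa fb []      = refl
erases-all {f} fa fb (a ∷ u) = cong₂ _++_ fa (erases-all {f} fa fb u)
erases-all {f} fa fb (b ∷ u) = cong₂ _++_ fb (erases-all {f} fa fb u)

sturmian-not-erasing : ∀ {f} → SturmianMorphism f → f a ≡ [] → ¬ (f b ≡ [])
sturmian-not-erasing {f} st fa fb =
  let w = mechanical a
      (_ , (_ , unbounded) , _) = st w (mechanical-sturmian a)
      (n , 1≤)                  = unbounded 1
  in contradiction (subst (λ u → 1 ≤ length u) (erases-all {f} fa fb (prefix w n)) 1≤) λ ()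

sturmian-balanced : ∀ {f} → SturmianMorphism f → BalancedFrom 0 f
sturmian-balanced {f} st = balancedFrom λ c →
  let (v , fw≈v , bal , _) = st (mechanical c) (mechanical-sturmian c)
  in image-balanced {f} {mechanical c} {v} fw≈v bal

mainTheorem4 : (f : Morphism) → SturmianMorphism f → ¬ (f ≗ E) → ¬ (f ≗ Id) → QuasiperiodicMorphism f
mainTheorem4 f st f≢E f≢Id = by-erasure (empty? (f a)) (empty? (f b))
  where
  by-kind : f a ≢ [] → f b ≢ [] → LetterMap f ⊎ Related f → QuasiperiodicMorphism f
  by-kind _  _  (inj₁ (a , fa , fb)) = contradiction (λ { a → fa ; b → fb }) f≢Id
  by-kind _  _  (inj₁ (b , fa , fb)) = contradiction (λ { a → fa ; b → fb }) f≢E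
  by-kind _  fb (inj₂ rel@(a , _))   = related-quasiperiodic rel (nonempty-length fb)
  by-kind fa _  (inj₂ rel@(b , _))   = related-quasiperiodic rel (nonempty-length fa)
  by-erasure : f a ≡ [] ⊎ f a ≢ [] → f b ≡ [] ⊎ f b ≢ [] → QuasiperiodicMorphism f
  by-erasure (inj₁ fa) (inj₁ fb) = contradiction fb (sturmian-not-erasing {f} st fa)
  by-erasure (inj₁ fa) (inj₂ fb) = erasing-quasiperiodic a fa fb
  by-erasure (inj₂ fa) (inj₁ fb) = erasing-quasiperiodic b fb fa
  by-erasure (inj₂ fa) (inj₂ fb) = by-kind fa fb (letterMap⊎related (suc ∥ f ∥) ≤-refl
    (λ { a → fa ; b → fb }) (sturmian-balanced {f} st))
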